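{- Fix an integer base $b\ge2$. Let $\mathcal{N}$ be a collection of periodic increasing sequences $n_1<n_2<n_3<\dots$ of positive integers. Suppose there exist $K,L\in\mathbb{N}$ such that for every $n\in\mathbb{N}$, the set $\{K(n-1)+L,\,K(n-1)+L+1,\,\dots,\,Kn+L-1\}$ is not a subset of (the set of terms of) any of the sequences in $\mathcal{N}$. Then there exists a real number $0.a_1a_2a_3\dots\in[0,1)$ that is not base-$b$ normal, yet $0.a_{n_1}a_{n_2}a_{n_3}\dots$ is base-$b$ normal for every sequence $n_1<n_2<\dots$ in $\mathcal{N}$.
   Context: $\mathbb{N}=\{1,2,3,\dots\}$. A set $A\subset\mathbb{N}$ (identified with the increasing sequence of its elements) is periodic if there exists $m\in\mathbb{N}$ such that $(A-m)\cap\mathbb{N}=A$, where $A-m=\{a-m:a\in A\}$. For a digit sequence $(a_i)$ with $a_i\in\{0,\dots,b-1\}$, $0.a_1a_2a_3\dots$ is (base-$b$) normal if for every $k\ge1$ and every string $[d_1,\dots,d_k]$ of digits in $\{0,\dots,b-1\}$, $\lim_{n\to\infty}\frac{1}{n}\#\{0\le i\le n-1: a_{i+j}=d_j, j=1,\dots,k\}=b^{ -k}$. -}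

module Defs where

open import Data.Nat as ℕ using (ℕ; zero; suc; _+_; _*_; _∸_; _^_; _≤_; _<_; NonZero)
open import Data.Nat.Properties using (m^n≢0)
open import Data.Fin using (Fin)
open import Data.Fin.Properties using (_≟_)
open import Data.Bool using (Bool; true; false; _∧_; if_then_else_)
open import Data.List using (List; []; _∷_; length)
open import Data.Integer using (+_)
open import Data.Rational as ℚ using (ℚ; _/_; ∣_∣; _-_; 0ℚ)
open import Data.Product using (Σ; ∃; _×_; _,_)
open import Relation.Binary.PropositionalEquality using (_≡_)
open import Relation.Nullary.Decidable using (⌊_⌋)

-- Conventions: sequences indexed by positive integers are modelled as
-- functions ℕ → _ whose value at 0 is ignored (a_i = a i for i ≥ 1).
-- A digit sequence in base b is  a : ℕ → Fin b  (a 0 is junk, never used).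

matches : ∀ {b} → (ℕ → Fin b) → ℕ → List (Fin b) → Bool
matches a i []      = true
matches a i (c ∷ w) = ⌊ a (suc i) ≟ c ⌋ ∧ matches a (suc i) w

count : ∀ {b} → (ℕ → Fin b) → List (Fin b) → ℕ → ℕ
count a w zero    = 0
count a w (suc n) = count a w n + (if matches a n w then 1 else 0)

Normal : (b : ℕ) .{{_ : NonZero b}} → (ℕ → Fin b) → Set
Normal b a =
  (w : List (Fin b)) → (ε : ℚ) → ℚ.Positive ε →
  ∃ λ N → (n : ℕ) → N ≤ n →
    ℚ._<_ ∣ ((+ count a w (suc n)) / suc n) - ((+ 1) / (b ^ length w)) {{m^n≢0 b (length w)}} ∣ ε

-- A sequence n₁ < n₂ < … of positive integers, given as s with s j = n_{j+1}.
StrictlyIncreasingPos : (ℕ → ℕ) → Set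
StrictlyIncreasingPos s = (1 ≤ s 0) × ((j : ℕ) → s j < s (suc j))

_∈ₛ_ : ℕ → (ℕ → ℕ) → Set
x ∈ₛ s = ∃ λ j → s j ≡ x

-- The set A of terms of s is periodic: ∃ m ∈ ℕ with (A - m) ∩ ℕ = A,
-- i.e. for every x ≥ 1:  x + m ∈ A ⇔ x ∈ A.
Periodic : (ℕ → ℕ) → Set
Periodic s = ∃ λ m → (1 ≤ m) ×
  ((x : ℕ) → 1 ≤ x → ((x + m) ∈ₛ s → x ∈ₛ s) × (x ∈ₛ s → (x + m) ∈ₛ s))

BlockSubset : ℕ → ℕ → ℕ → (ℕ → ℕ) → Set
BlockSubset K L n s = (x : ℕ) → K * (n ∸ 1) + L ≤ x → x < K * n + L → x ∈ₛ s

-- the digit sequence a_{n₁} a_{n₂} … (again with junk at index 0)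
subseq : ∀ {b} → (ℕ → Fin b) → (ℕ → ℕ) → ℕ → Fin b
subseq a s zero    = a zero
subseq a s (suc j) = a (s j)

{-# OPTIONS --safe #-}
-- Cut the positions from L on into blocks of length K, and let the last digit
-- of each block be the sum modulo b of its K - 1 other, free digits.  Whatever
-- the free digits are, the word 0^(K-1) 1 0^(K-1) does not occur beyond L,
-- because it would give a block with a single digit 1; so the sequence is not
-- normal.  A sequence in the collection misses a position of every block.
-- Hence, averaging over the free digits of a block, each selected digit is
-- uniform even given the selected digits before it: for a word c r the
-- quantity b [c r ends here] - [r ends here] has average zero.  A periodic
-- selection and a word form a test, and there are countably many tests.
-- Choosing the free digits of the blocks one block at a time so that
-- Σ S² grows no faster than on average, S being the running sums of the tests,
-- with test j taken into account from block j² on, gives S = o(n) for every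
-- test.  Normality along a selection follows by induction on the word.
module Submission where

open import Defs
open import Data.Nat as ℕ using (ℕ; zero; suc; _≤_; _<_; NonZero; z≤n; s≤s)
import Data.Nat.Properties as ℕₚ
import Data.Nat.DivMod as ℕ
import Data.Nat.Tactic.RingSolver as ℕ-Solver
open import Data.Nat.Binary as ℕᵇ using (ℕᵇ; 2[1+_]; 1+[2_])
import Data.Nat.Binary.Properties as ℕᵇₚ
open import Data.Bool using (Bool; true; false; if_then_else_; _∧_)
import Data.Bool.Properties as Boolₚ
open import Data.Integer as ℤ using (ℤ; +_; 0ℤ; ∣_∣; _+_; _*_; _-_; -_)
import Data.Integer.Properties as ℤₚ
open import Data.Integer.Tactic.RingSolver using (solve-∀)
open import Data.Rational as ℚ using (ℚ; mkℚ; _/_)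
import Data.Rational.Properties as ℚₚ
open import Data.Rational.Unnormalised as ℚᵘ using (ℚᵘ; mkℚᵘ)
import Data.Rational.Unnormalised.Properties as ℚᵘₚ
open import Data.Fin using (Fin; zero; suc; toℕ; fromℕ<)
import Data.Fin.Properties as Finₚ
open import Data.Fin.Permutation using (Permutation′; permutation)
open import Data.List using (List; []; _∷_; length; _++_; replicate; map; applyUpTo; reverse; _ʳ++_)
open import Data.List.Properties using (length-reverse)
open import Data.Vec using (Vec; []; _∷_; _[_]≔_)
open import Data.Product using (Σ; ∃; _×_; _,_; proj₁; proj₂)
open import Data.Sum using (inj₁; inj₂)
open import Function using (_∘_)
open import Relation.Nullary using (¬_; Dec; yes; no; contradiction)
open import Relation.Nullary.Decidable using (⌊_⌋; isYes≗does; does; _×-dec_; decidable-stable)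
open import Relation.Binary.PropositionalEquality
open import Relation.Binary.Definitions using (tri<; tri≈; tri>)
open import Algebra.Properties.CommutativeMonoid.Sum ℤₚ.+-0-commutativeMonoid
  using (sum; sum-cong-≗; sum-permute; ∑-comm; ∑-distrib-+; sum-replicate-zero)

-- Finite sums of integers

∑< : ℕ → (ℕ → ℤ) → ℤ
∑< zero    f = 0ℤ
∑< (suc n) f = ∑< n f + f n

∑<-cong : ∀ n {f g : ℕ → ℤ} → (∀ i → i < n → f i ≡ g i) → ∑< n f ≡ ∑< n g
∑<-cong zero    f≡g = refl
∑<-cong (suc n) f≡g =
  cong₂ _+_ (∑<-cong n λ i i<n → f≡g i (ℕₚ.m<n⇒m<1+n i<n)) (f≡g n ℕₚ.≤-refl)

∑<-zero : ∀ n {f : ℕ → ℤ} → (∀ i → i < n → f i ≡ 0ℤ) → ∑< n f ≡ 0ℤ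
∑<-zero zero    f≡0 = refl
∑<-zero (suc n) f≡0 =
  cong₂ _+_ (∑<-zero n λ i i<n → f≡0 i (ℕₚ.m<n⇒m<1+n i<n)) (f≡0 n ℕₚ.≤-refl)

∑<-split : ∀ m n f → ∑< (m ℕ.+ n) f ≡ ∑< m f + ∑< n (λ i → f (m ℕ.+ i))
∑<-split m zero    f rewrite ℕₚ.+-identityʳ m = sym (ℤₚ.+-identityʳ _)
∑<-split m (suc n) f rewrite ℕₚ.+-suc m n =
  trans (cong (_+ f (m ℕ.+ n)) (∑<-split m n f)) (ℤₚ.+-assoc (∑< m f) _ _)

∑<-abs : ∀ n {f : ℕ → ℤ} {B} → (∀ i → ∣ f i ∣ ≤ B) → ∣ ∑< n f ∣ ≤ n ℕ.* B
∑<-abs zero    f≤B = z≤n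
∑<-abs (suc n) {f} {B} f≤B =
  ℕₚ.≤-trans (ℤₚ.∣i+j∣≤∣i∣+∣j∣ (∑< n f) (f n))
    (ℕₚ.≤-trans (ℕₚ.+-mono-≤ (∑<-abs n f≤B) (f≤B n)) (ℕₚ.≤-reflexive (ℕₚ.+-comm (n ℕ.* B) B)))

∑<-truncate : ∀ m n f → m ≤ n → (∀ i → m ≤ i → f i ≡ 0ℤ) → ∑< n f ≡ ∑< m f
∑<-truncate m n f m≤n f≡0 = begin
  ∑< n f                                     ≡⟨ cong (λ k → ∑< k f) (ℕₚ.m+[n∸m]≡n m≤n) ⟨
  ∑< (m ℕ.+ (n ℕ.∸ m)) f                     ≡⟨ ∑<-split m (n ℕ.∸ m) f ⟩
  ∑< m f + ∑< (n ℕ.∸ m) (λ i → f (m ℕ.+ i))  ≡⟨ cong (λ z → ∑< m f + z) tail≡0 ⟩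
  ∑< m f + 0ℤ                                ≡⟨ ℤₚ.+-identityʳ _ ⟩
  ∑< m f                                     ∎
  where
  open ≡-Reasoning
  tail≡0 : ∑< (n ℕ.∸ m) (λ i → f (m ℕ.+ i)) ≡ 0ℤ
  tail≡0 = ∑<-zero (n ℕ.∸ m) λ i _ → f≡0 (m ℕ.+ i) (ℕₚ.m≤m+n m i)

i²≡∣i∣² : ∀ i → i * i ≡ + (∣ i ∣ ℕ.* ∣ i ∣)
i²≡∣i∣² (+ n)      = sym (ℤₚ.pos-* n n)
i²≡∣i∣² ℤ.-[1+ n ] = refl

0≤i² : ∀ i → 0ℤ ℤ.≤ i * i
0≤i² i = subst (0ℤ ℤ.≤_) (sym (i²≡∣i∣² i)) (ℤ.+≤+ z≤n)

term≤∑< : ∀ n {f : ℕ → ℤ} → (∀ i → 0ℤ ℤ.≤ f i) → ∀ {i} → i < n → f i ℤ.≤ ∑< n f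
term≤∑< (suc n) {f} 0≤f {i} i<1+n with ℕₚ.m<1+n⇒m<n∨m≡n i<1+n
... | inj₁ i<n  = ℤₚ.≤-trans (ℤₚ.≤-reflexive (sym (ℤₚ.+-identityʳ (f i)))) (ℤₚ.+-mono-≤ (term≤∑< n 0≤f i<n) (0≤f n))
... | inj₂ refl = ℤₚ.≤-trans (ℤₚ.≤-reflexive (sym (ℤₚ.+-identityˡ (f i)))) (ℤₚ.+-monoˡ-≤ (f n) (0≤∑< n))
  where
  0≤∑< : ∀ n → 0ℤ ℤ.≤ ∑< n f
  0≤∑< zero    = ℤₚ.≤-refl
  0≤∑< (suc n) = ℤₚ.+-mono-≤ (0≤∑< n) (0≤f n)

-- Greedy choice

-- Averages are left unnormalised, so a plain sum over all choices is an instance. The field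
-- `avg-≤0` is the first-moment principle behind every choice made below.
record Averaging (V : Set) : Set where
  field
    avg    : (V → ℤ) → ℤ
    avg-+  : ∀ f g → avg (λ v → f v + g v) ≡ avg f + avg g
    avg-*  : ∀ c f → avg (λ v → c * f v) ≡ c * avg f
    avg-≤0 : ∀ f → avg f ℤ.≤ 0ℤ → ∃ λ v → f v ℤ.≤ 0ℤ

  avg-0 : avg (λ _ → 0ℤ) ≡ 0ℤ
  avg-0 = avg-* 0ℤ (λ _ → 0ℤ)

  avg-∑< : ∀ n (f : ℕ → V → ℤ) → avg (λ v → ∑< n (λ i → f i v)) ≡ ∑< n (λ i → avg (f i))
  avg-∑< zero    f = avg-0
  avg-∑< (suc n) f = trans (avg-+ _ _) (cong (_+ avg (f n)) (avg-∑< n f))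

-- The method of conditional expectations: every new v is chosen so that the
-- cross terms 2 S D in the growth of Σ S² are in total not positive.
module Greedy
  {V H : Set} (A : Averaging V) (h₀ : H) (ext : ℕ → H → V → H)
  (D : ℕ → ℕ → H → ℤ) (C : ℕ)
  (D-avg : ∀ j n h → Averaging.avg A (λ v → D j n (ext n h v)) ≡ 0ℤ)
  (D-bound : ∀ j n h → D j n h * D j n h ℤ.≤ + C)
  (D-local : ∀ j m n h v → m < n → D j m (ext n h v) ≡ D j m h)
  (D-late : ∀ j n h → n < j ℕ.* j → D j n h ≡ 0ℤ)
  where
  open Averaging A

  S : ℕ → ℕ → H → ℤ
  S j n h = ∑< n (λ m → D j m h)

  cross : ℕ → H → V → ℕ → ℤ
  cross n h v j = S j n h * D j n (ext n h v)

  -- `S j n h` is fixed before `v` is chosen, so each cross term has average zero by linearity. The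
  -- cut-off `suc n` already covers every test that can be active at stage `n`.
  choice : ∀ n h → ∃ λ v → ∑< (suc n) (cross n h v) ℤ.≤ 0ℤ
  choice n h = avg-≤0 (λ v → ∑< (suc n) (cross n h v)) (ℤₚ.≤-reflexive
    (trans (avg-∑< (suc n) (λ j v → cross n h v j))
      (∑<-zero (suc n) λ j _ → trans (avg-* (S j n h) (λ v → D j n (ext n h v)))
        (trans (cong (S j n h *_) (D-avg j n h)) (ℤₚ.*-zeroʳ (S j n h))))))

  state  : ℕ → H
  chosen : ℕ → V
  state zero    = h₀
  state (suc n) = ext n (state n) (chosen n)
  chosen n = proj₁ (choice n (state n))

  E : ℕ → ℕ → ℤ
  E T n = ∑< T (λ j → S j n (state n) * S j n (state n))

  late⇒zero : ∀ T n → n < T ℕ.* T → ∀ h j → T ≤ j → D j n h ≡ 0ℤ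
  late⇒zero T n n<T² h j T≤j = D-late j n h (ℕₚ.<-≤-trans n<T² (ℕₚ.*-mono-≤ T≤j T≤j))

  -- The choice at stage `n` controls the sum with cut-off `suc n`. As `n < T * T`, tests from `T`
  -- on are still inactive, so the cut-off `T` gives the same sum.
  cross-≤0 : ∀ T n → n < T ℕ.* T → ∑< T (cross n (state n) (chosen n)) ℤ.≤ 0ℤ
  cross-≤0 T n n<T² = subst (ℤ._≤ 0ℤ) (sym eq) (proj₂ (choice n (state n)))
    where
    c = cross n (state n) (chosen n)
    c≡0 : ∀ U → n < U ℕ.* U → ∀ j → U ≤ j → c j ≡ 0ℤ
    c≡0 U n<U² j U≤j = trans (cong (S j n (state n) *_) (late⇒zero U n n<U² _ j U≤j)) (ℤₚ.*-zeroʳ (S j n (state n)))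
    eq : ∑< T c ≡ ∑< (suc n) c
    eq with ℕₚ.≤-total T (suc n)
    ... | inj₁ T≤ = sym (∑<-truncate T (suc n) c T≤ (c≡0 T n<T²))
    ... | inj₂ ≤T = ∑<-truncate (suc n) T c ≤T (c≡0 (suc n) (ℕₚ.m≤m*n (suc n) (suc n)))

  -- Expand `(s + d) * (s + d)`: the cross terms total at most zero, and each of the `T` squares
  -- `d * d` is at most `C`.
  E-step : ∀ T n → n < T ℕ.* T → E T (suc n) ℤ.≤ E T n + + (T ℕ.* C)
  E-step T n n<T² = begin
    E T (suc n)                                        ≡⟨ expand T ⟩
    E T n + (+ 2 * ∑< T c + ∑< T (λ j → d j * d j))    ≤⟨ ℤₚ.+-monoʳ-≤ (E T n) (ℤₚ.+-mono-≤ 2c≤0 (squares T)) ⟩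
    E T n + (0ℤ + + (T ℕ.* C))                         ≡⟨ cong (λ z → E T n + z) (ℤₚ.+-identityˡ _) ⟩
    E T n + + (T ℕ.* C)                                ∎
    where
    open ℤₚ.≤-Reasoning
    h = state n
    v = chosen n
    c = cross n h v
    d = λ j → D j n (ext n h v)
    2c≤0 : + 2 * ∑< T c ℤ.≤ 0ℤ
    2c≤0 = ℤₚ.*-monoˡ-≤-nonNeg (+ 2) (cross-≤0 T n n<T²)
    S-step : ∀ j → S j (suc n) (ext n h v) ≡ S j n h + d j
    S-step j = cong (_+ d j) (∑<-cong n λ m m<n → D-local j m n h v m<n)
    ring : ∀ e s d x y → e + (+ 2 * x + y) + (s + d) * (s + d)
         ≡ e + s * s + (+ 2 * (x + s * d) + (y + d * d))
    ring = solve-∀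
    expand : ∀ U → ∑< U (λ j → S j (suc n) (state (suc n)) * S j (suc n) (state (suc n)))
           ≡ ∑< U (λ j → S j n h * S j n h) + (+ 2 * ∑< U c + ∑< U (λ j → d j * d j))
    expand zero    = refl
    expand (suc U) = trans (cong₂ (λ p q → p + q * q) (expand U) (S-step U))
      (ring (∑< U (λ j → S j n h * S j n h)) (S U n h) (d U) (∑< U c) (∑< U (λ j → d j * d j)))
    squares : ∀ U → ∑< U (λ j → d j * d j) ℤ.≤ + (U ℕ.* C)
    squares zero    = ℤₚ.≤-refl
    squares (suc U) = ℤₚ.≤-trans (ℤₚ.+-mono-≤ (squares U) (D-bound U n (ext n h v)))
      (ℤₚ.≤-reflexive (cong +_ (ℕₚ.+-comm (U ℕ.* C) C)))

  E-bound : ∀ T n → n ≤ T ℕ.* T → E T n ℤ.≤ + (n ℕ.* (T ℕ.* C))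
  E-bound T zero    _    = ℤₚ.≤-reflexive (∑<-zero T λ _ _ → refl)
  E-bound T (suc n) n<T² = ℤₚ.≤-trans (E-step T n n<T²)
    (ℤₚ.≤-trans (ℤₚ.+-monoˡ-≤ (+ (T ℕ.* C)) (E-bound T n (ℕₚ.<⇒≤ n<T²)))
      (ℤₚ.≤-reflexive (cong +_ (ℕₚ.+-comm (n ℕ.* (T ℕ.* C)) (T ℕ.* C)))))

  S²-bound : ∀ T n j → n ≤ T ℕ.* T → j < T →
    ∣ S j n (state n) ∣ ℕ.* ∣ S j n (state n) ∣ ≤ n ℕ.* (T ℕ.* C)
  S²-bound T n j n≤T² j<T = ℤₚ.drop‿+≤+ (ℤₚ.≤-trans (ℤₚ.≤-reflexive (sym (i²≡∣i∣² (S j n (state n)))))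
    (ℤₚ.≤-trans (term≤∑< T (λ i → 0≤i² (S i n (state n))) j<T) (E-bound T n n≤T²)))

-- Sublinear growth

-- f n = o(n)
Sublinear : (ℕ → ℤ) → Set
Sublinear f = ∀ q → ∃ λ N → ∀ n → N ≤ n → q ℕ.* ∣ f n ∣ ≤ n

double-≤⇒≤ : ∀ {x y z} → 2 ℕ.* x ≤ z → 2 ℕ.* y ≤ z → x ℕ.+ y ≤ z
double-≤⇒≤ {x} {y} {z} 2x≤z 2y≤z = ℕₚ.*-cancelˡ-≤ 2 (begin
  2 ℕ.* (x ℕ.+ y)       ≡⟨ ℕₚ.*-distribˡ-+ 2 x y ⟩
  2 ℕ.* x ℕ.+ 2 ℕ.* y   ≤⟨ ℕₚ.+-mono-≤ 2x≤z 2y≤z ⟩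
  z ℕ.+ z               ≡⟨ cong (z ℕ.+_) (sym (ℕₚ.+-identityʳ z)) ⟩
  2 ℕ.* z               ∎)
  where open ℕₚ.≤-Reasoning

sublinear-cong : ∀ f g → (∀ n → f n ≡ g n) → Sublinear f → Sublinear g
sublinear-cong f g f≡g o q = proj₁ (o q) , λ n N≤n →
  subst (λ z → q ℕ.* ∣ z ∣ ≤ n) (f≡g n) (proj₂ (o q) n N≤n)

sublinear-bounded : ∀ f C → (∀ n → ∣ f n ∣ ≤ C) → Sublinear f
sublinear-bounded f C f≤C q = q ℕ.* C , λ n qC≤n → ℕₚ.≤-trans (ℕₚ.*-monoʳ-≤ q (f≤C n)) qC≤n

-- A change of index: `g` at `N` controls `f` at `X` as long as `N` tends to infinity and is at most
-- linear in `X`. It serves to pass from blocks to positions, from positions to selected terms, and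
-- from ends to starts of words.
sublinear-dominated : ∀ f g → Sublinear g → ∀ c C →
  (∀ M → ∃ λ X₀ → ∀ X → X₀ ≤ X → ∃ λ N →
    M ≤ N × N ≤ suc c ℕ.* X × ∣ f X ∣ ≤ C ℕ.+ ∣ g N ∣) →
  Sublinear f
-- Half of `X` pays for the constant `C` and half for `g`; the factor `suc c` absorbs
-- `N ≤ suc c * X`.
sublinear-dominated f g o c C dom q with o (suc c ℕ.* (2 ℕ.* q))
... | M , small with dom M
... | X₀ , bound = X₀ ℕ.⊔ 2 ℕ.* (q ℕ.* C) , λ X X≥ →
  let N , M≤N , N≤ , f≤ = bound X (ℕₚ.m⊔n≤o⇒m≤o X₀ _ X≥)
      gN = ∣ g N ∣
      2qg≤X : 2 ℕ.* (q ℕ.* gN) ≤ X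
      2qg≤X = ℕₚ.*-cancelˡ-≤ (suc c) (begin
        suc c ℕ.* (2 ℕ.* (q ℕ.* gN))   ≡⟨ cong (suc c ℕ.*_) (ℕₚ.*-assoc 2 q gN) ⟨
        suc c ℕ.* ((2 ℕ.* q) ℕ.* gN)   ≡⟨ ℕₚ.*-assoc (suc c) (2 ℕ.* q) gN ⟨
        suc c ℕ.* (2 ℕ.* q) ℕ.* gN     ≤⟨ small N M≤N ⟩
        N                              ≤⟨ N≤ ⟩
        suc c ℕ.* X                    ∎)
  in begin
    q ℕ.* ∣ f X ∣            ≤⟨ ℕₚ.*-monoʳ-≤ q f≤ ⟩
    q ℕ.* (C ℕ.+ gN)         ≡⟨ ℕₚ.*-distribˡ-+ q C gN ⟩
    q ℕ.* C ℕ.+ q ℕ.* gN     ≤⟨ double-≤⇒≤ {q ℕ.* C} (ℕₚ.m⊔n≤o⇒n≤o X₀ _ X≥) 2qg≤X ⟩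
    X                        ∎
  where open ℕₚ.≤-Reasoning

sublinear-+ : ∀ f g → Sublinear f → Sublinear g → Sublinear (λ n → f n + g n)
sublinear-+ f g o₁ o₂ q with o₁ (2 ℕ.* q) | o₂ (2 ℕ.* q)
... | M , f≤ | N , g≤ = M ℕ.⊔ N , λ n ≥ → begin
  q ℕ.* ∣ f n + g n ∣                ≤⟨ ℕₚ.*-monoʳ-≤ q (ℤₚ.∣i+j∣≤∣i∣+∣j∣ (f n) (g n)) ⟩
  q ℕ.* (∣ f n ∣ ℕ.+ ∣ g n ∣)        ≡⟨ ℕₚ.*-distribˡ-+ q ∣ f n ∣ ∣ g n ∣ ⟩
  q ℕ.* ∣ f n ∣ ℕ.+ q ℕ.* ∣ g n ∣    ≤⟨ double-≤⇒≤ {q ℕ.* ∣ f n ∣}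
    (subst (_≤ n) (ℕₚ.*-assoc 2 q _) (f≤ n (ℕₚ.m⊔n≤o⇒m≤o M N ≥)))
    (subst (_≤ n) (ℕₚ.*-assoc 2 q _) (g≤ n (ℕₚ.m⊔n≤o⇒n≤o M N ≥))) ⟩
  n                                  ∎
  where open ℕₚ.≤-Reasoning

sublinear-* : ∀ c f → Sublinear f → Sublinear (λ n → c * f n)
sublinear-* c f o q with o (q ℕ.* ∣ c ∣)
... | N , f≤ = N , λ n N≤n → subst (_≤ n)
  (trans (ℕₚ.*-assoc q ∣ c ∣ ∣ f n ∣) (cong (q ℕ.*_) (sym (ℤₚ.abs-* c (f n))))) (f≤ n N≤n)

square-cancel-≤ : ∀ m n → m ℕ.* m ≤ n ℕ.* n → m ≤ n
square-cancel-≤ m n m²≤n² = ℕₚ.≮⇒≥ λ n<m → ℕₚ.<⇒≱ (ℕₚ.*-mono-< n<m n<m) m²≤n²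

-- With T = n / (q² C) both n ≤ T² and q² T C ≤ n hold for large n.
sublinear-sqrt : ∀ (f : ℕ → ℤ) (C j : ℕ) →
  (∀ T n → n ≤ T ℕ.* T → j < T → ∣ f n ∣ ℕ.* ∣ f n ∣ ≤ n ℕ.* (T ℕ.* C)) →
  Sublinear f
sublinear-sqrt f C j bound q = U ℕ.* d , λ n Ud≤n →
  let T = n ℕ./ d
      U≤T : U ≤ T
      U≤T = subst (_≤ T) (ℕ.m*n/n≡m U d) (ℕ./-monoˡ-≤ d Ud≤n)
      1≤T : 1 ≤ T
      1≤T = ℕₚ.≤-trans (s≤s z≤n) U≤T
      j<T : j < T
      j<T = ℕₚ.≤-trans (ℕₚ.m≤m+n (suc j) (2 ℕ.* d)) U≤T
      2d≤T : 2 ℕ.* d ≤ T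
      2d≤T = ℕₚ.≤-trans (ℕₚ.m≤n+m (2 ℕ.* d) (suc j)) U≤T
      n≤T² : n ≤ T ℕ.* T
      n≤T² = begin
        n                       ≡⟨ ℕ.m≡m%n+[m/n]*n n d ⟩
        n ℕ.% d ℕ.+ T ℕ.* d     ≤⟨ ℕₚ.+-monoˡ-≤ (T ℕ.* d) (ℕₚ.<⇒≤ (ℕ.m%n<n n d)) ⟩
        d ℕ.+ T ℕ.* d           ≤⟨ ℕₚ.+-monoˡ-≤ (T ℕ.* d) (ℕₚ.m≤n*m d T {{ℕ.>-nonZero 1≤T}}) ⟩
        T ℕ.* d ℕ.+ T ℕ.* d     ≡⟨ fold T d ⟩
        T ℕ.* (2 ℕ.* d)         ≤⟨ ℕₚ.*-monoʳ-≤ T 2d≤T ⟩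
        T ℕ.* T                 ∎
      small : (q ℕ.* ∣ f n ∣) ℕ.* (q ℕ.* ∣ f n ∣) ≤ n ℕ.* n
      small = begin
        (q ℕ.* ∣ f n ∣) ℕ.* (q ℕ.* ∣ f n ∣)     ≡⟨ squares q ∣ f n ∣ ⟩
        (q ℕ.* q) ℕ.* (∣ f n ∣ ℕ.* ∣ f n ∣)     ≤⟨ ℕₚ.*-monoʳ-≤ (q ℕ.* q) (bound T n n≤T² j<T) ⟩
        (q ℕ.* q) ℕ.* (n ℕ.* (T ℕ.* C))         ≡⟨ regroup q n T C ⟩
        n ℕ.* (T ℕ.* (q ℕ.* q ℕ.* C))           ≤⟨ ℕₚ.*-monoʳ-≤ n (ℕₚ.*-monoʳ-≤ T (ℕₚ.n≤1+n (q ℕ.* q ℕ.* C))) ⟩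
        n ℕ.* (T ℕ.* d)                         ≤⟨ ℕₚ.*-monoʳ-≤ n (ℕ.m/n*n≤m n d) ⟩
        n ℕ.* n                                 ∎
  in square-cancel-≤ _ _ small
  where
  open ℕₚ.≤-Reasoning
  -- The successor keeps the divisor positive. From `U * d ≤ n` follow `j < T` and `2 * d ≤ T`, and
  -- then `n ≤ d + T * d ≤ T * (2 * d) ≤ T * T`.
  d = suc (q ℕ.* q ℕ.* C)
  U = suc j ℕ.+ 2 ℕ.* d
  fold : ∀ t d → t ℕ.* d ℕ.+ t ℕ.* d ≡ t ℕ.* (2 ℕ.* d)
  fold = ℕ-Solver.solve-∀
  squares : ∀ q x → (q ℕ.* x) ℕ.* (q ℕ.* x) ≡ (q ℕ.* q) ℕ.* (x ℕ.* x)
  squares = ℕ-Solver.solve-∀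
  regroup : ∀ q n t c → (q ℕ.* q) ℕ.* (n ℕ.* (t ℕ.* c)) ≡ n ℕ.* (t ℕ.* (q ℕ.* q ℕ.* c))
  regroup = ℕ-Solver.solve-∀

-- Distances of rationals

module _ (c n B : ℕ) .{{_ : NonZero B}} where

  distance : ℚ
  distance = ℚ.∣ ((+ c) / suc n) ℚ.- ((+ 1) / B) ∣

  error : ℕ
  error = ∣ (+ B) * (+ c) - + suc n ∣

-- Both fractions are put over the common denominator `suc n * B`. This is done with unnormalised
-- rationals, as reduction to lowest terms hides the denominators.
distance-≃ : ∀ c n B .{{_ : NonZero B}} →
  ℚ.toℚᵘ (distance c n B) ℚᵘ.≃ mkℚᵘ (+ error c n B) (ℕ.pred (suc n ℕ.* B))
distance-≃ c n B@(suc B-1) = begin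
  ℚ.toℚᵘ ℚ.∣ x ℚ.- y ∣                  ≈⟨ ℚₚ.toℚᵘ-homo-∣-∣ (x ℚ.- y) ⟩
  ℚᵘ.∣ ℚ.toℚᵘ (x ℚ.- y) ∣               ≈⟨ ℚᵘₚ.∣-∣-cong (ℚₚ.toℚᵘ-homo-+ x (ℚ.- y)) ⟩
  ℚᵘ.∣ ℚ.toℚᵘ x ℚᵘ.+ ℚ.toℚᵘ (ℚ.- y) ∣   ≈⟨ ℚᵘₚ.∣-∣-cong (ℚᵘₚ.+-cong x≃ -y≃) ⟩
  ℚᵘ.∣ mkℚᵘ (+ c) n ℚᵘ.- mkℚᵘ (+ 1) B-1 ∣  ≡⟨ cong absolute (numerator (+ c) (+ B) (+ suc n)) ⟩
  mkℚᵘ (+ error c n B) (ℕ.pred (suc n ℕ.* B))  ∎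
  where
  open ℚᵘₚ.≃-Reasoning
  x = (+ c) / suc n
  y = (+ 1) / B
  x≃ = ℚₚ.toℚᵘ-fromℚᵘ (mkℚᵘ (+ c) n)
  -y≃ = ℚᵘₚ.≃-trans (ℚₚ.toℚᵘ-homo‿- y) (ℚᵘₚ.-‿cong (ℚₚ.toℚᵘ-fromℚᵘ (mkℚᵘ (+ 1) B-1)))
  absolute : ℤ → ℚᵘ
  absolute z = mkℚᵘ (+ ∣ z ∣) (ℕ.pred (suc n ℕ.* B))
  numerator : ∀ c b n → c * b + (- (+ 1)) * n ≡ b * c - n
  numerator = solve-∀

distance-< : ∀ c n B .{{_ : NonZero B}} ε → ℚ.Positive ε →
  suc (ℚ.denominator-1 ε) ℕ.* error c n B < suc n ℕ.* B → distance c n B ℚ.< ε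
distance-< c n B@(suc B-1) (mkℚ (+ suc p) d _) _ small = ℚₚ.toℚᵘ-cancel-<
  (ℚᵘₚ.<-respˡ-≃ (ℚᵘₚ.≃-sym (distance-≃ c n B)) (ℚᵘ.*<* (subst₂ ℤ._<_
    (ℤₚ.pos-* (error c n B) (suc d)) (ℤₚ.pos-* (suc p) (suc n ℕ.* B)) (ℤ.+<+ (begin-strict
      error c n B ℕ.* suc d      ≡⟨ ℕₚ.*-comm (error c n B) (suc d) ⟩
      suc d ℕ.* error c n B      <⟨ small ⟩
      suc n ℕ.* B                ≤⟨ ℕₚ.m≤n*m (suc n ℕ.* B) (suc p) ⟩
      suc p ℕ.* (suc n ℕ.* B)    ∎)))))
  where open ℕₚ.≤-Reasoning

distance-<⁻¹ : ∀ c n B .{{_ : NonZero B}} E →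
  distance c n B ℚ.< (+ 1) / suc E → suc E ℕ.* error c n B < suc n ℕ.* B
distance-<⁻¹ c n B@(suc B-1) E lt
  with ℚᵘₚ.<-respˡ-≃ (distance-≃ c n B) (ℚᵘₚ.<-respʳ-≃ (ℚₚ.toℚᵘ-fromℚᵘ (mkℚᵘ (+ 1) E)) (ℚₚ.toℚᵘ-mono-< lt))
... | ℚᵘ.*<* lt′ = subst₂ _<_ (ℕₚ.*-comm (error c n B) (suc E)) (ℕₚ.*-identityˡ (suc n ℕ.* B))
  (ℤₚ.drop‿+<+ (subst₂ ℤ._<_ (sym (ℤₚ.pos-* (error c n B) (suc E))) (sym (ℤₚ.pos-* 1 (suc n ℕ.* B))) lt′))

-- Digits modulo b

ind : Bool → ℤ
ind true  = + 1
ind false = 0ℤ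

-- The factor `M` is kept apart from the number `n` of letters so that induction on `n` applies;
-- with `M` equal to `n` the sum vanishes.
sum-weight : ∀ n (M : ℤ) (d : Fin n) → sum (λ c → M * ind (does (c Finₚ.≟ d)) - + 1) ≡ M - + n
sum-weight (suc n) M zero = trans (cong (λ z → M * + 1 - + 1 + z)
    (trans (sum-cong-≗ {n} {λ i → M * 0ℤ - + 1} λ i → ring₀ M) (minus-ones n))) (ring₁ M (+ n))
  where
  ring₀ : ∀ M → M * + 0 - + 1 ≡ - + 1
  ring₀ = solve-∀
  minus-ones : ∀ n → sum {n} (λ _ → - + 1) ≡ - + n
  minus-ones zero    = refl
  minus-ones (suc n) = trans (cong (λ z → - + 1 + z) (minus-ones n)) (sym (ℤₚ.neg-distrib-+ (+ 1) (+ n)))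
  ring₁ : ∀ M n → M * + 1 - + 1 + - n ≡ M - (+ 1 + n)
  ring₁ = solve-∀
sum-weight (suc n) M (suc d) = trans (cong (λ z → M * 0ℤ - + 1 + z) (sum-weight n M d)) (ring M (+ n))
  where
  ring : ∀ M n → M * + 0 - + 1 + (M - n) ≡ M - (+ 1 + n)
  ring = solve-∀

sum-*ˡ : ∀ n c (f : Fin n → ℤ) → sum (λ i → c * f i) ≡ c * sum f
sum-*ˡ zero    c f = sym (ℤₚ.*-zeroʳ c)
sum-*ˡ (suc n) c f = trans (cong (λ z → c * f zero + z) (sum-*ˡ n c (f ∘ suc))) (sym (ℤₚ.*-distribˡ-+ c (f zero) _))

sum-≤0 : ∀ n (f : Fin (suc n) → ℤ) → sum f ℤ.≤ 0ℤ → ∃ λ i → f i ℤ.≤ 0ℤ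
sum-≤0 n f Σ≤0 with f zero ℤ.≤? 0ℤ
... | yes f₀≤0 = zero , f₀≤0
sum-≤0 zero    f Σ≤0 | no f₀≰0 = contradiction (subst (ℤ._≤ 0ℤ) (ℤₚ.+-identityʳ (f zero)) Σ≤0) f₀≰0
sum-≤0 (suc n) f Σ≤0 | no f₀≰0 =
  let i , fi≤0 = sum-≤0 n (f ∘ suc) (ℤₚ.≤-trans (ℤₚ.≤-trans (ℤₚ.≤-reflexive (sym (ℤₚ.+-identityˡ _)))
                   (ℤₚ.+-monoˡ-≤ (sum (f ∘ suc)) (ℤₚ.<⇒≤ (ℤₚ.≰⇒> f₀≰0)))) Σ≤0)
  in suc i , fi≤0

module Digits (b-1 : ℕ) where

  b : ℕ
  b = suc b-1

  ∑V : ∀ k → (Vec (Fin b) k → ℤ) → ℤ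
  ∑V zero    f = f []
  ∑V (suc k) f = ∑V k (λ v → sum (λ c → f (c ∷ v)))

  ∑V-cong : ∀ k {f g} → (∀ v → f v ≡ g v) → ∑V k f ≡ ∑V k g
  ∑V-cong zero    f≡g = f≡g []
  ∑V-cong (suc k) f≡g = ∑V-cong k λ v → sum-cong-≗ λ c → f≡g (c ∷ v)

  ∑V-+ : ∀ k f g → ∑V k (λ v → f v + g v) ≡ ∑V k f + ∑V k g
  ∑V-+ zero    f g = refl
  ∑V-+ (suc k) f g = trans (∑V-cong k λ v → ∑-distrib-+ (λ c → f (c ∷ v)) (λ c → g (c ∷ v))) (∑V-+ k _ _)

  ∑V-* : ∀ k c f → ∑V k (λ v → c * f v) ≡ c * ∑V k f
  ∑V-* zero    c f = refl
  ∑V-* (suc k) c f = trans (∑V-cong k λ v → sum-*ˡ b c λ d → f (d ∷ v)) (∑V-* k c _)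

  ∑V-≤0 : ∀ k f → ∑V k f ℤ.≤ 0ℤ → ∃ λ v → f v ℤ.≤ 0ℤ
  ∑V-≤0 zero    f ≤0 = [] , ≤0
  ∑V-≤0 (suc k) f ≤0 =
    let v , sum≤0 = ∑V-≤0 k _ ≤0
        c , f≤0   = sum-≤0 b-1 (λ c → f (c ∷ v)) sum≤0
    in c ∷ v , f≤0

  vecAveraging : ∀ k → Averaging (Vec (Fin b) k)
  vecAveraging k = record
    { avg = ∑V k ; avg-+ = ∑V-+ k ; avg-* = ∑V-* k ; avg-≤0 = ∑V-≤0 k }

  -- Summing first over coordinate `r` splits the vectors into lines, on each of which `f` sums to
  -- zero.
  ∑V-coordinate : ∀ {k} (r : Fin k) f → (∀ v → sum (λ c → f (v [ r ]≔ c)) ≡ 0ℤ) → ∑V k f ≡ 0ℤ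
  ∑V-coordinate {suc k} zero f ≡0 =
    trans (∑V-cong k λ v → ≡0 (zero ∷ v)) (Averaging.avg-0 (vecAveraging k))
  ∑V-coordinate {suc k} (suc r) f ≡0 = ∑V-coordinate r _ λ v →
    trans (∑-comm (λ c d → f (d ∷ (v [ r ]≔ c))))
      (trans (sum-cong-≗ λ d → ≡0 (d ∷ v)) (sum-replicate-zero b))

  infixl 6 _⊕_ _⊖_

  mod : ℕ → Fin b
  mod n = fromℕ< (ℕ.m%n<n n b)

  _⊕_ _⊖_ : Fin b → Fin b → Fin b
  x ⊕ y = mod (toℕ x ℕ.+ toℕ y)
  x ⊖ y = mod (toℕ x ℕ.+ (b ℕ.∸ toℕ y))

  toℕ-mod : ∀ n → toℕ (mod n) ≡ n ℕ.% b
  toℕ-mod n = Finₚ.toℕ-fromℕ< _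

  mod-toℕ : ∀ x → mod (toℕ x) ≡ x
  mod-toℕ x = Finₚ.toℕ-injective (trans (toℕ-mod (toℕ x)) (ℕ.m<n⇒m%n≡m (Finₚ.toℕ<n x)))

  ⊕-comm : ∀ x y → x ⊕ y ≡ y ⊕ x
  ⊕-comm x y = cong mod (ℕₚ.+-comm (toℕ x) (toℕ y))

  ⊕-identityˡ : ∀ x → zero ⊕ x ≡ x
  ⊕-identityˡ = mod-toℕ

  ⊕-identityʳ : ∀ x → x ⊕ zero ≡ x
  ⊕-identityʳ x = trans (⊕-comm x zero) (⊕-identityˡ x)

  -- One identity gives both inverse laws of a translation, with `m` and `n` taken as `toℕ y` and
  -- `b ∸ toℕ y` in either order.
  mod-cancel : ∀ x m n → m ℕ.+ n ≡ b → mod (toℕ (mod (toℕ x ℕ.+ m)) ℕ.+ n) ≡ x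
  mod-cancel x m n m+n≡b = Finₚ.toℕ-injective (begin
    toℕ (mod (toℕ (mod (toℕ x ℕ.+ m)) ℕ.+ n))           ≡⟨ toℕ-mod (toℕ (mod (toℕ x ℕ.+ m)) ℕ.+ n) ⟩
    (toℕ (mod (toℕ x ℕ.+ m)) ℕ.+ n) ℕ.% b               ≡⟨ cong (λ z → (z ℕ.+ n) ℕ.% b) (toℕ-mod (toℕ x ℕ.+ m)) ⟩
    ((toℕ x ℕ.+ m) ℕ.% b ℕ.+ n) ℕ.% b                   ≡⟨ ℕ.%-distribˡ-+ ((toℕ x ℕ.+ m) ℕ.% b) n b ⟩
    ((toℕ x ℕ.+ m) ℕ.% b ℕ.% b ℕ.+ n ℕ.% b) ℕ.% b       ≡⟨ cong (λ z → (z ℕ.+ n ℕ.% b) ℕ.% b) (ℕ.m%n%n≡m%n (toℕ x ℕ.+ m) b) ⟩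
    ((toℕ x ℕ.+ m) ℕ.% b ℕ.+ n ℕ.% b) ℕ.% b             ≡⟨ ℕ.%-distribˡ-+ (toℕ x ℕ.+ m) n b ⟨
    (toℕ x ℕ.+ m ℕ.+ n) ℕ.% b                           ≡⟨ cong (ℕ._% b) (ℕₚ.+-assoc (toℕ x) m n) ⟩
    (toℕ x ℕ.+ (m ℕ.+ n)) ℕ.% b                         ≡⟨ cong (λ z → (toℕ x ℕ.+ z) ℕ.% b) m+n≡b ⟩
    (toℕ x ℕ.+ b) ℕ.% b                                 ≡⟨ ℕ.[m+n]%n≡m%n (toℕ x) b ⟩
    toℕ x ℕ.% b                                         ≡⟨ ℕ.m<n⇒m%n≡m (Finₚ.toℕ<n x) ⟩
    toℕ x                                               ∎)
    where open ≡-Reasoning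

  translation : Fin b → Permutation′ b
  translation y = permutation (_⊕ y) (_⊖ y)
    (λ x → mod-cancel x (b ℕ.∸ toℕ y) (toℕ y) (ℕₚ.m∸n+n≡m y≤b))
    (λ x → mod-cancel x (toℕ y) (b ℕ.∸ toℕ y) (ℕₚ.m+[n∸m]≡n y≤b))
    where y≤b = ℕₚ.<⇒≤ (Finₚ.toℕ<n y)

  sum-⊕ʳ : ∀ y (f : Fin b → ℤ) → sum (λ c → f (c ⊕ y)) ≡ sum f
  sum-⊕ʳ y f = sym (sum-permute f (translation y))

  sum-⊕ˡ : ∀ x (f : Fin b → ℤ) → sum (λ c → f (x ⊕ c)) ≡ sum f
  sum-⊕ˡ x f = trans (sum-cong-≗ λ c → cong f (⊕-comm x c)) (sum-⊕ʳ x f)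

  total : ∀ {k} → Vec (Fin b) k → Fin b
  total []      = zero
  total (c ∷ v) = c ⊕ total v

  -- With the other entries fixed, the total is a translate of entry `r`, and translations permute
  -- the residues.
  sum-total : ∀ {k} (v : Vec (Fin b) k) r (f : Fin b → ℤ) → sum (λ c → f (total (v [ r ]≔ c))) ≡ sum f
  sum-total (_ ∷ v) zero    f = sum-⊕ʳ (total v) f
  sum-total (d ∷ v) (suc r) f = trans (sum-total v r (λ c → f (d ⊕ c))) (sum-⊕ˡ d f)

  -- The entries of v, followed by d forever.
  lookupOr : ∀ {k} → Vec (Fin b) k → Fin b → ℕ → Fin b
  lookupOr []      d _       = d
  lookupOr (c ∷ v) d zero    = c
  lookupOr (c ∷ v) d (suc i) = lookupOr v d i

  lookupOr-≥ : ∀ {k} (v : Vec (Fin b) k) d i → k ≤ i → lookupOr v d i ≡ d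
  lookupOr-≥ []      d i       _         = refl
  lookupOr-≥ (c ∷ v) d (suc i) (s≤s k≤i) = lookupOr-≥ v d i k≤i

  lookupOr-≔ : ∀ {k} (v : Vec (Fin b) k) r c d → lookupOr (v [ r ]≔ c) d (toℕ r) ≡ c
  lookupOr-≔ (_ ∷ v) zero    c d = refl
  lookupOr-≔ (_ ∷ v) (suc r) c d = lookupOr-≔ v r c d

  -- The defaults `d` and `d′` may differ because in a block the default is the total, which changes
  -- with entry `r`; an index below `k` never reaches it.
  lookupOr-≔-≢ : ∀ {k} (v : Vec (Fin b) k) r c d d′ i → i ≢ toℕ r → i < k →
    lookupOr (v [ r ]≔ c) d i ≡ lookupOr v d′ i
  lookupOr-≔-≢ (_ ∷ v) zero    c d d′ zero    i≢r _ = contradiction refl i≢r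
  lookupOr-≔-≢ (_ ∷ v) zero    c d d′ (suc i) i≢r (s≤s i<k) = same v i i<k
    where
    same : ∀ {k} (v : Vec (Fin b) k) i → i < k → lookupOr v d i ≡ lookupOr v d′ i
    same (_ ∷ v) zero    _         = refl
    same (_ ∷ v) (suc i) (s≤s i<k) = same v i i<k
  lookupOr-≔-≢ (_ ∷ v) (suc r) c d d′ zero    i≢r _ = refl
  lookupOr-≔-≢ (_ ∷ v) (suc r) c d d′ (suc i) i≢r (s≤s i<k) = lookupOr-≔-≢ v r c d d′ i (i≢r ∘ cong suc) i<k

  -- The default of the lookup acts as a check digit: index `k` lies just past the free digits and
  -- returns their total.
  block : ∀ {k} → Vec (Fin b) k → ℕ → Fin b
  block v = lookupOr v (total v)

  total-zero : ∀ {k} (v : Vec (Fin b) k) d → (∀ i → i < k → lookupOr v d i ≡ zero) → total v ≡ zero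
  total-zero []      d v≡0 = refl
  total-zero (c ∷ v) d v≡0 =
    trans (cong₂ _⊕_ (v≡0 0 (s≤s z≤n)) (total-zero v d λ i i<k → v≡0 (suc i) (s≤s i<k))) (⊕-identityˡ zero)

  total-single : ∀ {k} (v : Vec (Fin b) k) d e t → t < k → lookupOr v d t ≡ e →
    (∀ i → i < k → i ≢ t → lookupOr v d i ≡ zero) → total v ≡ e
  total-single (c ∷ v) d e zero    _         refl v≡0 =
    trans (cong (c ⊕_) (total-zero v d λ i i<k → v≡0 (suc i) (s≤s i<k) λ ())) (⊕-identityʳ c)
  total-single (c ∷ v) d e (suc t) (s≤s t<k) v≡e  v≡0 =
    trans (cong₂ _⊕_ (v≡0 0 (s≤s z≤n) λ ())
      (total-single v d e t t<k v≡e λ i i<k i≢t → v≡0 (suc i) (s≤s i<k) (i≢t ∘ ℕₚ.suc-injective)))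
      (⊕-identityˡ e)

-- The digit sequence

ind-bound : ∀ p → ∣ ind p ∣ ≤ 1
ind-bound true  = ℕₚ.≤-refl
ind-bound false = z≤n

record Test (b : ℕ) : Set where
  constructor test
  field
    select : ℕ → Bool
    letter : Fin b
    past   : List (Fin b)

module Scores {b-1 : ℕ} where
  open Digits b-1

  -- Do the last selected positions below x carry the letters of the list,
  -- which is read backwards?
  precedes : (ℕ → Bool) → (ℕ → Fin b) → List (Fin b) → ℕ → Bool
  precedes χ a []      x       = true
  precedes χ a (c ∷ r) zero    = false
  precedes χ a (c ∷ r) (suc x) =
    if χ x then ⌊ a x Finₚ.≟ c ⌋ ∧ precedes χ a r x else precedes χ a (c ∷ r) x

  -- Agreement is only asked at selected positions, so altering the digit in a gap of the selection
  -- leaves the past unchanged.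
  precedes-cong : ∀ {χ a a′} r x → (∀ y → y < x → χ y ≡ true → a y ≡ a′ y) →
    precedes χ a r x ≡ precedes χ a′ r x
  precedes-cong []      x    eq = refl
  precedes-cong (c ∷ r) zero eq = refl
  precedes-cong {χ} (c ∷ r) (suc x) eq with χ x in χx
  ... | true  = cong₂ (λ d p → ⌊ d Finₚ.≟ c ⌋ ∧ p) (eq x ℕₚ.≤-refl χx)
                  (precedes-cong r x λ y y<x → eq y (ℕₚ.m<n⇒m<1+n y<x))
  ... | false = precedes-cong (c ∷ r) x λ y y<x → eq y (ℕₚ.m<n⇒m<1+n y<x)

  -- A letter c contributes b - 1, every other letter - 1, so that the weights
  -- of all letters cancel.
  weight : Fin b → Fin b → ℤ
  weight c d = + b * ind ⌊ d Finₚ.≟ c ⌋ - + 1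

  weight-bound : ∀ c d → ∣ weight c d ∣ ≤ b
  weight-bound c d with ⌊ d Finₚ.≟ c ⌋
  ... | true  rewrite ℕₚ.*-identityʳ b-1 = ℕₚ.n≤1+n b-1
  ... | false rewrite ℕₚ.*-zeroʳ b-1     = s≤s z≤n

  sum-weight-zero : ∀ c → sum (weight c) ≡ 0ℤ
  sum-weight-zero c = begin
    sum (weight c)                                       ≡⟨ sum-cong-≗ {b} (λ d → cong (λ p → + b * ind p - + 1) (isYes≗does (d Finₚ.≟ c))) ⟩
    sum (λ d → + b * ind (does (d Finₚ.≟ c)) - + 1)      ≡⟨ sum-weight b (+ b) c ⟩
    + b - + b                                            ≡⟨ ℤₚ.+-inverseʳ (+ b) ⟩
    0ℤ                                                   ∎
    where open ≡-Reasoning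

  score : Test b → (ℕ → Fin b) → ℕ → ℤ
  score (test χ c r) a x = if χ x then ind (precedes χ a r x) * weight c (a x) else 0ℤ

  score-cong : ∀ τ {a a′} x → (∀ y → y ≤ x → a y ≡ a′ y) → score τ a x ≡ score τ a′ x
  score-cong (test χ c r) x eq with χ x
  ... | true  = cong₂ (λ p d → ind p * weight c d) (precedes-cong r x λ y y<x _ → eq y (ℕₚ.<⇒≤ y<x)) (eq x ℕₚ.≤-refl)
  ... | false = refl

  score-bound : ∀ τ a x → ∣ score τ a x ∣ ≤ b
  score-bound (test χ c r) a x with χ x
  ... | false = z≤n
  ... | true  = ℕₚ.≤-trans (ℕₚ.≤-reflexive (ℤₚ.abs-* (ind (precedes χ a r x)) (weight c (a x))))
    (ℕₚ.≤-trans (ℕₚ.*-mono-≤ (ind-bound (precedes χ a r x)) (weight-bound c (a x)))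
      (ℕₚ.≤-reflexive (ℕₚ.*-identityˡ b)))

-- The partition of the positions into blocks

module Blocks (k L : ℕ) (1≤L : 1 ≤ L) where

  base : ℕ → ℕ
  base n = L ℕ.+ n ℕ.* suc k

  base-mono : ∀ m n → m ≤ n → base m ≤ base n
  base-mono m n m≤n = ℕₚ.+-monoʳ-≤ L (ℕₚ.*-monoˡ-≤ (suc k) m≤n)

  base-suc : ∀ n → base (suc n) ≡ base n ℕ.+ suc k
  base-suc n = trans (cong (L ℕ.+_) (ℕₚ.+-comm (suc k) (n ℕ.* suc k))) (sym (ℕₚ.+-assoc L _ (suc k)))

  base+<base : ∀ m n {i} → m < n → i ≤ k → base m ℕ.+ i < base n
  base+<base m n {i} m<n i≤k = begin-strict
    base m ℕ.+ i        <⟨ ℕₚ.+-monoʳ-< (base m) (s≤s i≤k) ⟩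
    base m ℕ.+ suc k    ≡⟨ base-suc m ⟨
    base (suc m)        ≤⟨ base-mono (suc m) n m<n ⟩
    base n              ∎
    where open ℕₚ.≤-Reasoning

  n<base : ∀ n → n < base n
  n<base n = ℕₚ.+-mono-≤ 1≤L (ℕₚ.m≤m*n n (suc k))

  locate : ∀ x → L ≤ x → ∃ λ n → base n ≤ x × x < base (suc n)
  locate x L≤x = n , lower , upper
    where
    n = (x ℕ.∸ L) ℕ./ suc k
    x≡ : x ≡ base n ℕ.+ (x ℕ.∸ L) ℕ.% suc k
    x≡ = begin
      x                                                        ≡⟨ ℕₚ.m+[n∸m]≡n L≤x ⟨
      L ℕ.+ (x ℕ.∸ L)                                          ≡⟨ cong (L ℕ.+_) (ℕ.m≡m%n+[m/n]*n (x ℕ.∸ L) (suc k)) ⟩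
      L ℕ.+ ((x ℕ.∸ L) ℕ.% suc k ℕ.+ n ℕ.* suc k)              ≡⟨ cong (L ℕ.+_) (ℕₚ.+-comm ((x ℕ.∸ L) ℕ.% suc k) _) ⟩
      L ℕ.+ (n ℕ.* suc k ℕ.+ (x ℕ.∸ L) ℕ.% suc k)              ≡⟨ ℕₚ.+-assoc L _ _ ⟨
      base n ℕ.+ (x ℕ.∸ L) ℕ.% suc k                           ∎
      where open ≡-Reasoning
    lower : base n ≤ x
    lower = subst (base n ≤_) (sym x≡) (ℕₚ.m≤m+n (base n) _)
    upper : x < base (suc n)
    upper = subst (_< base (suc n)) (sym x≡) (base+<base n (suc n) ℕₚ.≤-refl (ℕₚ.≤-pred (ℕ.m%n<n (x ℕ.∸ L) (suc k))))

  Gap : (ℕ → Bool) → ℕ → Set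
  Gap χ n = ∃ λ q → q < suc k × χ (base n ℕ.+ q) ≡ false

  gap? : ∀ χ n → Dec (Gap χ n)
  gap? χ n = ℕₚ.anyUpTo? (λ q → χ (base n ℕ.+ q) Boolₚ.≟ false) (suc k)

-- The greedy construction of the digits

module Construction (b-1 k L : ℕ) (1≤L : 1 ≤ L) (tests : ℕ → Test (suc b-1)) where
  open Digits b-1
  open Scores {b-1}
  open Blocks k L 1≤L

  -- All positions from `base n` on are overwritten; those after the block hold the check digit
  -- provisionally, until later stages replace them.
  ext : ℕ → (ℕ → Fin b) → Vec (Fin b) k → ℕ → Fin b
  ext n a v x with x ℕ.<? base n
  ... | yes _ = a x
  ... | no _  = block v (x ℕ.∸ base n)

  ext-< : ∀ n a v {x} → x < base n → ext n a v x ≡ a x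
  ext-< n a v {x} x< with x ℕ.<? base n
  ... | yes _ = refl
  ... | no x≮ = contradiction x< x≮

  ext-≥ : ∀ n a v i → ext n a v (base n ℕ.+ i) ≡ block v i
  ext-≥ n a v i with base n ℕ.+ i ℕ.<? base n
  ... | yes x< = contradiction x< (ℕₚ.≤⇒≯ (ℕₚ.m≤m+n (base n) i))
  ... | no _   = cong (block v) (ℕₚ.m+n∸m≡n (base n) i)

  -- Only positions before `base n + i` with `i ≤ k` are compared, which leaves out the check digit:
  -- it may change with entry `r`.
  ext-≔ : ∀ n a v r c i → i ≤ k → ∀ y → y < base n ℕ.+ i → y ≢ base n ℕ.+ toℕ r →
    ext n a (v [ r ]≔ c) y ≡ ext n a v y
  ext-≔ n a v r c i i≤k y y<x y≢ with y ℕ.<? base n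
  ... | yes _ = refl
  ... | no y≮ = lookupOr-≔-≢ v r c _ _ (y ℕ.∸ base n)
          (λ eq → y≢ (trans (sym y≡) (cong (λ z → base n ℕ.+ z) eq)))
          (ℕₚ.+-cancelˡ-< (base n) _ _ (subst (_< base n ℕ.+ k) (sym y≡) (ℕₚ.<-≤-trans y<x (ℕₚ.+-monoʳ-≤ (base n) i≤k))))
    where y≡ = ℕₚ.m+[n∸m]≡n (ℕₚ.≮⇒≥ y≮)

  -- Varying entry `ρ` leaves the earlier selected digits alone, so the past factors out, while the
  -- digit at `base n + i` takes each value once and the weights cancel.
  score-avg-along : ∀ χ c r n a i ρ → i ≤ k →
    (∀ y → y < base n ℕ.+ i → χ y ≡ true → y ≢ base n ℕ.+ toℕ ρ) →
    (∀ v f → sum (λ d → f (ext n a (v [ ρ ]≔ d) (base n ℕ.+ i))) ≡ sum f) →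
    ∑V k (λ v → ind (precedes χ (ext n a v) r (base n ℕ.+ i)) * weight c (ext n a v (base n ℕ.+ i))) ≡ 0ℤ
  score-avg-along χ c r n a i ρ i≤k unseen uniform = ∑V-coordinate ρ _ λ v →
    let p = λ v → ind (precedes χ (ext n a v) r x) in begin
    sum (λ d → p (v [ ρ ]≔ d) * weight c (ext n a (v [ ρ ]≔ d) x))   ≡⟨ sum-cong-≗ {b} (λ d → cong (_* weight c (ext n a (v [ ρ ]≔ d) x)) (past v d)) ⟩
    sum (λ d → p v * weight c (ext n a (v [ ρ ]≔ d) x))              ≡⟨ sum-*ˡ b (p v) (λ d → weight c (ext n a (v [ ρ ]≔ d) x)) ⟩
    p v * sum (λ d → weight c (ext n a (v [ ρ ]≔ d) x))              ≡⟨ cong (p v *_) (uniform v (weight c)) ⟩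
    p v * sum (weight c)                                             ≡⟨ cong (p v *_) (sum-weight-zero c) ⟩
    p v * 0ℤ                                                         ≡⟨ ℤₚ.*-zeroʳ (p v) ⟩
    0ℤ                                                               ∎
    where
    open ≡-Reasoning
    x = base n ℕ.+ i
    past : ∀ v d → ind (precedes χ (ext n a (v [ ρ ]≔ d)) r x) ≡ ind (precedes χ (ext n a v) r x)
    past v d = cong ind
      (precedes-cong r x λ y y<x χy → ext-≔ n a v ρ d i i≤k y y<x (unseen y y<x χy))

  -- The digit at a selected position is equidistributed along one free
  -- coordinate of the block: its own one, or, for the last position, that of
  -- the gap.
  score-avg : ∀ τ n a → Gap (Test.select τ) n → ∀ i → i ≤ k →
    ∑V k (λ v → score τ (ext n a v) (base n ℕ.+ i)) ≡ 0ℤ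
  score-avg (test χ c r) n a (q , q≤k , χq) i i≤k with χ (base n ℕ.+ i) in χi
  ... | false = Averaging.avg-0 (vecAveraging k)
  ... | true with ℕₚ.m≤n⇒m<n∨m≡n i≤k
  ... | inj₁ i<k = score-avg-along χ c r n a i ρ i≤k
          (λ y y<x _ y≡ → ℕₚ.<-irrefl (trans y≡ (cong (λ z → base n ℕ.+ z) ρ≡i)) y<x)
          (λ v f → sum-cong-≗ λ d → cong f (own v d))
    where
    ρ = fromℕ< i<k
    ρ≡i = Finₚ.toℕ-fromℕ< i<k
    own : ∀ v d → ext n a (v [ ρ ]≔ d) (base n ℕ.+ i) ≡ d
    own v d = trans (ext-≥ n a (v [ ρ ]≔ d) i)
      (trans (cong (block (v [ ρ ]≔ d)) (sym ρ≡i)) (lookupOr-≔ v ρ d (total (v [ ρ ]≔ d))))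
  ... | inj₂ refl = score-avg-along χ c r n a k ρ ℕₚ.≤-refl
          (λ y _ χy y≡ → true≢false (trans (sym χy) (trans (cong χ (trans y≡ (cong (λ z → base n ℕ.+ z) ρ≡q))) χq)))
          (λ v f → trans (sum-cong-≗ λ d → cong f (last v d)) (sum-total v ρ f))
    where
    true≢false : true ≢ false
    true≢false ()
    -- The last position of the block is selected here, so the gap has to be a free position.
    q<k : q < k
    q<k = ℕₚ.≤∧≢⇒< (ℕₚ.≤-pred q≤k) λ { refl → true≢false (trans (sym χi) χq) }
    ρ = fromℕ< q<k
    ρ≡q = Finₚ.toℕ-fromℕ< q<k
    last : ∀ v d → ext n a (v [ ρ ]≔ d) (base n ℕ.+ k) ≡ total (v [ ρ ]≔ d)
    last v d = trans (ext-≥ n a (v [ ρ ]≔ d) k) (lookupOr-≥ (v [ ρ ]≔ d) _ k ℕₚ.≤-refl)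

  -- The enumeration contains every periodic selection, also those that fill a whole block; a test
  -- counts in block `n` only if its selection leaves a gap there.
  Active : ℕ → ℕ → Set
  Active j n = (j ℕ.* j ≤ n) × Gap (Test.select (tests j)) n

  active? : ∀ j n → Dec (Active j n)
  active? j n = (j ℕ.* j ℕ.≤? n) ×-dec gap? (Test.select (tests j)) n

  blockScore : ℕ → ℕ → (ℕ → Fin b) → ℤ
  blockScore j n a = ∑< (suc k) (λ i → score (tests j) a (base n ℕ.+ i))

  D : ℕ → ℕ → (ℕ → Fin b) → ℤ
  D j n a with active? j n
  ... | yes _ = blockScore j n a
  ... | no _  = 0ℤ

  D-active : ∀ j n a → Active j n → D j n a ≡ blockScore j n a
  D-active j n a act with active? j n
  ... | yes _  = refl
  ... | no ¬act = contradiction act ¬act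

  D-cong : ∀ j n {a a′} → (∀ y → y < base (suc n) → a y ≡ a′ y) → D j n a ≡ D j n a′
  D-cong j n eq with active? j n
  ... | no _  = refl
  ... | yes _ = ∑<-cong (suc k) λ i i<1+k → score-cong (tests j) (base n ℕ.+ i) λ y y≤ →
    eq y (ℕₚ.≤-<-trans y≤ (base+<base n (suc n) ℕₚ.≤-refl (ℕₚ.≤-pred i<1+k)))

  D-avg : ∀ j n a → ∑V k (λ v → D j n (ext n a v)) ≡ 0ℤ
  D-avg j n a with active? j n
  ... | no _            = Averaging.avg-0 (vecAveraging k)
  ... | yes (_ , gap) = trans (Averaging.avg-∑< (vecAveraging k) (suc k) (λ i v → score (tests j) (ext n a v) (base n ℕ.+ i)))
    (∑<-zero (suc k) λ i i<1+k → score-avg (tests j) n a gap i (ℕₚ.≤-pred i<1+k))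

  blockScore-bound : ∀ j n a → ∣ blockScore j n a ∣ ≤ suc k ℕ.* b
  blockScore-bound j n a = ∑<-abs (suc k) λ i → score-bound (tests j) a (base n ℕ.+ i)

  C : ℕ
  C = (suc k ℕ.* b) ℕ.* (suc k ℕ.* b)

  D-bound : ∀ j n a → D j n a * D j n a ℤ.≤ + C
  D-bound j n a with active? j n
  ... | no _  = ℤ.+≤+ z≤n
  ... | yes _ = ℤₚ.≤-trans (ℤₚ.≤-reflexive (i²≡∣i∣² (blockScore j n a)))
    (ℤ.+≤+ (ℕₚ.*-mono-≤ (blockScore-bound j n a) (blockScore-bound j n a)))

  D-local : ∀ j m n a v → m < n → D j m (ext n a v) ≡ D j m a
  D-local j m n a v m<n = D-cong j m λ y y< → ext-< n a v (ℕₚ.<-≤-trans y< (base-mono (suc m) n m<n))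

  D-late : ∀ j n a → n < j ℕ.* j → D j n a ≡ 0ℤ
  D-late j n a n<j² with active? j n
  ... | no _           = refl
  ... | yes (j²≤n , _) = contradiction j²≤n (ℕₚ.<⇒≱ n<j²)

  module G = Greedy (vecAveraging k) (λ _ → zero) ext D C D-avg D-bound D-local D-late

  -- The diagonal of the stages is their limit: stage `x` has settled all positions below `base x`,
  -- and `x < base x`.
  digit : ℕ → Fin b
  digit x = G.state x x

  state-stable : ∀ m n {x} → m ≤ n → x < base m → G.state n x ≡ G.state m x
  state-stable m n {x} m≤n x< =
    subst (λ n → G.state n x ≡ G.state m x) (ℕₚ.m∸n+n≡m m≤n) (go (n ℕ.∸ m))
    where
    go : ∀ d → G.state (d ℕ.+ m) x ≡ G.state m x
    go zero    = refl
    go (suc d) = trans (ext-< (d ℕ.+ m) _ _ (ℕₚ.<-≤-trans x< (base-mono m (d ℕ.+ m) (ℕₚ.m≤n+m m d)))) (go d)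

  digit-state : ∀ n {x} → x < base n → digit x ≡ G.state n x
  digit-state n {x} x< with ℕₚ.≤-total n x
  ... | inj₁ n≤x = state-stable n x n≤x x<
  ... | inj₂ x≤n = sym (state-stable x n x≤n (n<base x))

  digit-block : ∀ n i → i ≤ k → digit (base n ℕ.+ i) ≡ block (G.chosen n) i
  digit-block n i i≤k = trans (digit-state (suc n) (base+<base n (suc n) ℕₚ.≤-refl i≤k)) (ext-≥ n (G.state n) (G.chosen n) i)

  D-sublinear : ∀ j → Sublinear (λ n → ∑< n (λ m → D j m digit))
  D-sublinear j = sublinear-cong _ _
    (λ n → ∑<-cong n λ m m<n → D-cong j m λ y y< → sym (digit-state n (ℕₚ.<-≤-trans y< (base-mono (suc m) n m<n))))
    (sublinear-sqrt (λ n → G.S j n (G.state n)) C j λ T n → G.S²-bound T n j)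

  -- From block `j * j` on the test is always active, so at block boundaries the two sums differ by
  -- the fixed `offset`; the unfinished block adds at most `suc k * b`.
  score-sublinear : ∀ j → (∀ n → Gap (Test.select (tests j)) n) →
    Sublinear (λ x → ∑< x (score (tests j) digit))
  score-sublinear j gap = sublinear-dominated
    (λ x → ∑< x (score (tests j) digit)) (λ n → ∑< n (λ m → D j m digit))
    (D-sublinear j) 0 (∣ offset ∣ ℕ.+ suc k ℕ.* b)
    λ M → base (M ℕ.⊔ n₀) , λ x base≤x →
      let N , base≤ , <base = locate x (ℕₚ.≤-trans (ℕₚ.m≤m+n L _) base≤x)
          M⊔n₀≤N : M ℕ.⊔ n₀ ≤ N
          M⊔n₀≤N = ℕₚ.≮⇒≥ λ N< → ℕₚ.<⇒≱ <base (ℕₚ.≤-trans (base-mono (suc N) (M ℕ.⊔ n₀) N<) base≤x)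
          n₀≤N = ℕₚ.m⊔n≤o⇒n≤o M n₀ M⊔n₀≤N
          d = x ℕ.∸ base N
          ΣD = ∑< N (λ m → D j m digit)
          R = ∑< d (λ i → s (base N ℕ.+ i))
          x≡ = ℕₚ.m+[n∸m]≡n base≤
          d≤ : d ≤ suc k
          d≤ = ℕₚ.+-cancelˡ-≤ (base N) _ _ (subst₂ _≤_ (sym x≡) (base-suc N) (ℕₚ.<⇒≤ <base))
          R≤ : ∣ R ∣ ≤ suc k ℕ.* b
          R≤ = ℕₚ.≤-trans (∑<-abs d λ i → score-bound (tests j) digit (base N ℕ.+ i))
                 (ℕₚ.*-monoˡ-≤ b d≤)
          eq : ∑< x s ≡ offset + ΣD + R
          eq = trans (cong (λ z → ∑< z s) (sym x≡)) (trans (∑<-split (base N) d s)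
                 (cong (λ z → z + R) (subst (λ N → ∑< (base N) s ≡ offset + ∑< N (λ m → D j m digit))
                   (ℕₚ.m∸n+n≡m n₀≤N) (at-base (N ℕ.∸ n₀)))))
      in N , ℕₚ.m⊔n≤o⇒m≤o M n₀ M⊔n₀≤N
           , ℕₚ.≤-trans (ℕₚ.≤-trans (ℕₚ.<⇒≤ (n<base N)) base≤) (ℕₚ.≤-reflexive (sym (ℕₚ.*-identityˡ x)))
           , (begin
      ∣ ∑< x s ∣                                      ≡⟨ cong ∣_∣ eq ⟩
      ∣ offset + ΣD + R ∣                             ≤⟨ ℤₚ.∣i+j∣≤∣i∣+∣j∣ (offset + ΣD) R ⟩
      ∣ offset + ΣD ∣ ℕ.+ ∣ R ∣                       ≤⟨ ℕₚ.+-mono-≤ (ℤₚ.∣i+j∣≤∣i∣+∣j∣ offset ΣD) R≤ ⟩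
      ∣ offset ∣ ℕ.+ ∣ ΣD ∣ ℕ.+ suc k ℕ.* b           ≡⟨ shuffle ∣ offset ∣ ∣ ΣD ∣ (suc k ℕ.* b) ⟩
      ∣ offset ∣ ℕ.+ suc k ℕ.* b ℕ.+ ∣ ΣD ∣           ∎)
    where
    open ℕₚ.≤-Reasoning
    shuffle : ∀ x y z → x ℕ.+ y ℕ.+ z ≡ x ℕ.+ z ℕ.+ y
    shuffle x y z = trans (ℕₚ.+-assoc x y z) (trans (cong (x ℕ.+_) (ℕₚ.+-comm y z)) (sym (ℕₚ.+-assoc x z y)))
    n₀ = j ℕ.* j
    s = score (tests j) digit
    offset = ∑< (base n₀) s - ∑< n₀ (λ m → D j m digit)
    cancel : ∀ x y → x ≡ x - y + y
    cancel = solve-∀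
    at-base : ∀ d → ∑< (base (d ℕ.+ n₀)) s ≡ offset + ∑< (d ℕ.+ n₀) (λ m → D j m digit)
    at-base zero    = cancel (∑< (base n₀) s) (∑< n₀ (λ m → D j m digit))
    at-base (suc d) = trans (cong (λ z → ∑< z s) (base-suc (d ℕ.+ n₀)))
      (trans (∑<-split (base (d ℕ.+ n₀)) (suc k) s)
        (trans (cong₂ _+_ (at-base d) (sym (D-active j (d ℕ.+ n₀) digit (ℕₚ.m≤n+m n₀ d , gap (d ℕ.+ n₀)))))
          (ℤₚ.+-assoc offset _ _)))

-- Normality along a sequence

module Increasing (s : ℕ → ℕ) (inc : StrictlyIncreasingPos s) where

  mono-< : ∀ {i j} → i < j → s i < s j
  mono-< {i} {suc j} i<1+j with ℕₚ.m<1+n⇒m<n∨m≡n i<1+j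
  ... | inj₁ i<j  = ℕₚ.<-trans (mono-< i<j) (proj₂ inc j)
  ... | inj₂ refl = proj₂ inc i

  mono-≤ : ∀ {i j} → i ≤ j → s i ≤ s j
  mono-≤ i≤j with ℕₚ.m≤n⇒m<n∨m≡n i≤j
  ... | inj₁ i<j  = ℕₚ.<⇒≤ (mono-< i<j)
  ... | inj₂ refl = ℕₚ.≤-refl

  cancel-≤ : ∀ {i j} → s i ≤ s j → i ≤ j
  cancel-≤ si≤sj = ℕₚ.≮⇒≥ λ j<i → ℕₚ.<⇒≱ (mono-< j<i) si≤sj

  cancel-< : ∀ {i j} → s i < s j → i < j
  cancel-< si<sj = ℕₚ.≰⇒> λ j≤i → ℕₚ.<⇒≱ si<sj (mono-≤ j≤i)

  n<s : ∀ n → n < s n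
  n<s zero    = proj₁ inc
  n<s (suc n) = ℕₚ.<-≤-trans (s≤s (n<s n)) (proj₂ inc n)

  _∈?s : ∀ x → Dec (x ∈ₛ s)
  x ∈?s with ℕₚ.anyUpTo? (λ j → s j ℕₚ.≟ x) x
  ... | yes (j , _ , eq) = yes (j , eq)
  ... | no ∄j            = no λ { (j , refl) → ∄j (j , n<s j , refl) }

  -- `s n + m` is a later term, so `s (suc n)` is at most `s n + m`. A periodic selection thus has
  -- positive density, and what is small against positions is small against selected terms.
  linear : ∀ m → (∀ x → x ∈ₛ s → (x ℕ.+ m) ∈ₛ s) → 1 ≤ m → ∀ n → s n ≤ s 0 ℕ.+ n ℕ.* m
  linear m shift 1≤m zero    = ℕₚ.m≤m+n (s 0) 0
  linear m shift 1≤m (suc n) with shift (s n) (n , refl)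
  ... | i , si≡ = begin
    s (suc n)                     ≤⟨ mono-≤ (cancel-< {n} (subst (s n <_) (sym si≡) (ℕₚ.m<m+n (s n) 1≤m))) ⟩
    s i                           ≡⟨ si≡ ⟩
    s n ℕ.+ m                     ≤⟨ ℕₚ.+-monoˡ-≤ m (linear m shift 1≤m n) ⟩
    s 0 ℕ.+ n ℕ.* m ℕ.+ m         ≡⟨ ℕₚ.+-assoc (s 0) _ m ⟩
    s 0 ℕ.+ (n ℕ.* m ℕ.+ m)       ≡⟨ cong (s 0 ℕ.+_) (ℕₚ.+-comm (n ℕ.* m) m) ⟩
    s 0 ℕ.+ suc n ℕ.* m           ∎
    where open ℕₚ.≤-Reasoning

  -- s 0, …, s (j - 1) are exactly the terms of s below x.
  Below : ℕ → ℕ → Set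
  Below j x = (∀ i → i < j → s i < x) × x ≤ s j

  below-s : ∀ j → Below j (s j)
  below-s j = (λ i → mono-<) , ℕₚ.≤-refl

  below-zero : ∀ {j} → Below j 0 → j ≡ 0
  below-zero {zero}  _        = refl
  below-zero {suc j} (lt , _) = contradiction (lt 0 (s≤s z≤n)) λ ()

  below-∈ : ∀ {j x} → Below j (suc x) → x ∈ₛ s → ∃ λ i → j ≡ suc i × x ≡ s i
  below-∈ {zero}  (_  , ≤s) (i , refl) = contradiction (cancel-< {i} ≤s) λ ()
  below-∈ {suc j} (lt , ≤s) (i , refl) = j , refl , cong s (ℕₚ.≤-antisym
    (ℕₚ.≤-pred (cancel-< {i} ≤s)) (cancel-≤ (ℕₚ.≤-pred (lt j ℕₚ.≤-refl))))

  below-∉ : ∀ {j x} → Below j (suc x) → ¬ x ∈ₛ s → Below j x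
  below-∉ (lt , ≤s) x∉s =
    (λ i i<j → ℕₚ.≤∧≢⇒< (ℕₚ.≤-pred (lt i i<j)) λ eq → x∉s (i , eq)) , ℕₚ.<⇒≤ ≤s

everywhere : ℕ → Bool
everywhere _ = true

module Subsequence {b-1 : ℕ} (s : ℕ → ℕ) (inc : StrictlyIncreasingPos s)
  (χ : ℕ → Bool) (χ-sound : ∀ x → χ x ≡ true → x ∈ₛ s)
  (χ-complete : ∀ x → χ x ≡ false → ¬ x ∈ₛ s)
  (a : ℕ → Fin (suc b-1)) where
  open Scores {b-1}
  open Increasing s inc

  precedes-subseq : ∀ r j x → Below j x → precedes χ a r x ≡ precedes everywhere (a ∘ s) r j
  precedes-subseq []      j x    _   = refl
  precedes-subseq (c ∷ r) j zero bel rewrite below-zero bel = refl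
  precedes-subseq (c ∷ r) j (suc x) bel with χ x in χx
  ... | false = precedes-subseq (c ∷ r) j x (below-∉ bel (χ-complete x χx))
  ... | true with below-∈ bel (χ-sound x χx)
  ... | i , refl , refl = cong (⌊ a (s i) Finₚ.≟ c ⌋ ∧_) (precedes-subseq r i (s i) (below-s i))

  ∑-score-subseq : ∀ c r j x → Below j x →
    ∑< x (score (test χ c r) a) ≡ ∑< j (score (test everywhere c r) (a ∘ s))
  ∑-score-subseq c r j zero bel rewrite below-zero bel = refl
  ∑-score-subseq c r j (suc x) bel with χ x in χx
  ... | false = trans (ℤₚ.+-identityʳ _) (∑-score-subseq c r j x (below-∉ bel (χ-complete x χx)))
  ... | true with below-∈ bel (χ-sound x χx)
  ... | i , refl , refl = cong₂ (λ t p → t + ind p * weight c (a (s i)))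
          (∑-score-subseq c r i (s i) (below-s i)) (precedes-subseq r i (s i) (below-s i))

  score-subseq-sublinear : ∀ m → 1 ≤ m → (∀ x → x ∈ₛ s → (x ℕ.+ m) ∈ₛ s) → ∀ c r →
    Sublinear (λ x → ∑< x (score (test χ c r) a)) →
    Sublinear (λ n → ∑< n (score (test everywhere c r) (a ∘ s)))
  score-subseq-sublinear m 1≤m shift c r sub =
    sublinear-dominated (λ n → ∑< n (score (test everywhere c r) (a ∘ s))) (λ x → ∑< x (score (test χ c r) a))
      -- Starting at `suc M` ensures `1 ≤ n`, so that the constant `s 0` is absorbed into `s 0 * n`.
      sub (s 0 ℕ.+ m) 0 λ M → suc M , λ n M<n →
        s n , ℕₚ.<⇒≤ (ℕₚ.<-trans M<n (n<s n)) , bound n (ℕₚ.≤-trans (s≤s z≤n) M<n) ,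
        ℕₚ.≤-reflexive (cong ∣_∣ (sym (∑-score-subseq c r n (s n) (below-s n))))
    where
    bound : ∀ n → 1 ≤ n → s n ≤ suc (s 0 ℕ.+ m) ℕ.* n
    bound n@(suc _) _ = begin
      s n                       ≤⟨ linear m shift 1≤m n ⟩
      s 0 ℕ.+ n ℕ.* m           ≤⟨ ℕₚ.+-mono-≤ (ℕₚ.m≤m*n (s 0) n) (ℕₚ.≤-reflexive (ℕₚ.*-comm n m)) ⟩
      s 0 ℕ.* n ℕ.+ m ℕ.* n     ≡⟨ ℕₚ.*-distribʳ-+ n (s 0) m ⟨
      (s 0 ℕ.+ m) ℕ.* n         ≤⟨ ℕₚ.m≤n+m _ n ⟩
      suc (s 0 ℕ.+ m) ℕ.* n     ∎
      where open ℕₚ.≤-Reasoning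

ind-∧ : ∀ p q → ind (p ∧ q) ≡ ind p * ind q
ind-∧ true  q = sym (ℤₚ.*-identityˡ (ind q))
ind-∧ false q = sym (ℤₚ.*-zeroˡ (ind q))

-- From score sums to word frequencies

module Normality {b-1 : ℕ} (y : ℕ → Fin (suc b-1)) where
  open Digits b-1 using (b)
  open Scores {b-1}

  occurs : List (Fin b) → ℕ → ℤ
  occurs r n = ind (precedes everywhere y r n)

  occurs-suc : ∀ c r n → occurs (c ∷ r) (suc n) ≡ ind ⌊ y n Finₚ.≟ c ⌋ * occurs r n
  occurs-suc c r n = ind-∧ ⌊ y n Finₚ.≟ c ⌋ _

  -- An occurrence is recorded at the index just after its last letter, hence the shift to `suc n`
  -- on the left.
  ∑-score : ∀ c r n → + b * ∑< (suc n) (occurs (c ∷ r)) ≡ ∑< n (score (test everywhere c r) y) + ∑< n (occurs r)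
  ∑-score c r zero    = ℤₚ.*-zeroʳ (+ b)
  ∑-score c r (suc n) = begin
    + b * (g + occurs (c ∷ r) (suc n))          ≡⟨ cong (λ z → + b * (g + z)) (occurs-suc c r n) ⟩
    + b * (g + q * p)                           ≡⟨ ℤₚ.*-distribˡ-+ (+ b) g (q * p) ⟩
    + b * g + + b * (q * p)                     ≡⟨ cong (_+ + b * (q * p)) (∑-score c r n) ⟩
    t + u + + b * (q * p)                       ≡⟨ ring (+ b) q p t u ⟩
    t + p * (+ b * q - + 1) + (u + p)           ∎
    where
    open ≡-Reasoning
    g = ∑< (suc n) (occurs (c ∷ r))
    q = ind ⌊ y n Finₚ.≟ c ⌋
    p = occurs r n
    t = ∑< n (score (test everywhere c r) y)
    u = ∑< n (occurs r)
    ring : ∀ b q p t u → t + u + b * (q * p) ≡ t + p * (b * q - + 1) + (u + p)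
    ring = solve-∀

  -- The scaled discrepancy of a word: it is o(n) exactly when the frequency of `r` tends to `b` to
  -- the power minus its length.
  deviation : List (Fin b) → ℕ → ℤ
  deviation r n = + (b ℕ.^ length r) * ∑< n (occurs r) - + n

  -- The inductive step on words: the scores measure how far `c ∷ r` departs from its share of the
  -- occurrences of `r`. The last summand on the left removes the extra index of `∑-score`.
  deviation-suc : ∀ c r n → + (b ℕ.^ length r) * ∑< n (score (test everywhere c r) y) + deviation r n
    + - + (b ℕ.^ length (c ∷ r)) * occurs (c ∷ r) n ≡ deviation (c ∷ r) n
  deviation-suc c r n = subst (λ Q → P * t + (P * u - + n) + - Q * o ≡ Q * g - + n)
    (sym (ℤₚ.pos-* b (b ℕ.^ length r))) (begin
    P * t + (P * u - + n) + - (+ b * P) * o       ≡⟨ ring₁ P t u (+ n) (+ b) o ⟩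
    P * (t + u) - + n - + b * P * o               ≡⟨ cong (λ z → P * z - + n - + b * P * o) (∑-score c r n) ⟨
    P * (+ b * (g + o)) - + n - + b * P * o       ≡⟨ ring₂ P g (+ n) (+ b) o ⟩
    + b * P * g - + n                             ∎)
    where
    open ≡-Reasoning
    P = + (b ℕ.^ length r)
    t = ∑< n (score (test everywhere c r) y)
    u = ∑< n (occurs r)
    o = occurs (c ∷ r) n
    g = ∑< n (occurs (c ∷ r))
    ring₁ : ∀ P t u n b o → P * t + (P * u - n) + - (b * P) * o ≡ P * (t + u) - n - b * P * o
    ring₁ = solve-∀
    ring₂ : ∀ P g n b o → P * (b * (g + o)) - n - b * P * o ≡ b * P * g - n
    ring₂ = solve-∀

  module _ (sub : ∀ c r → Sublinear (λ n → ∑< n (score (test everywhere c r) y))) where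

    deviation-sublinear : ∀ r → Sublinear (deviation r)
    deviation-sublinear [] = sublinear-bounded (deviation []) 0 λ n → ℕₚ.≤-reflexive (cong ∣_∣ (zeroth n))
      where
      count-all : ∀ n → ∑< n (λ _ → + 1) ≡ + n
      count-all zero    = refl
      count-all (suc n) = trans (cong (_+ + 1) (count-all n)) (cong +_ (ℕₚ.+-comm n 1))
      zeroth : ∀ n → deviation [] n ≡ 0ℤ
      zeroth n = trans (cong (_- + n) (trans (ℤₚ.*-identityˡ _) (count-all n))) (ℤₚ.+-inverseʳ (+ n))
    deviation-sublinear (c ∷ r) = sublinear-cong (λ n → f₁ n + f₂ n + f₃ n) (deviation (c ∷ r)) (deviation-suc c r)
      (sublinear-+ (λ n → f₁ n + f₂ n) f₃
        (sublinear-+ f₁ f₂ (sublinear-* (+ (b ℕ.^ length r)) (λ n → ∑< n (score (test everywhere c r) y)) (sub c r))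
          (deviation-sublinear r))
        (sublinear-* (- + (b ℕ.^ length (c ∷ r))) (occurs (c ∷ r))
          (sublinear-bounded (occurs (c ∷ r)) 1 λ n → ind-bound (precedes everywhere y (c ∷ r) n))))
      where
      f₁ f₂ f₃ : ℕ → ℤ
      f₁ n = + (b ℕ.^ length r) * ∑< n (score (test everywhere c r) y)
      f₂ = deviation r
      f₃ n = - + (b ℕ.^ length (c ∷ r)) * occurs (c ∷ r) n

    module _ (y′ : ℕ → Fin b) (shifted : ∀ n → y′ (suc n) ≡ y n) where

      -- Forward matching is compared with backward reading by moving the letters of `w` one at a
      -- time onto `r`, as `ʳ++` does.
      matches-precedes : ∀ w r i →
        precedes everywhere y (w ʳ++ r) (length w ℕ.+ i) ≡ matches y′ i w ∧ precedes everywhere y r i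
      matches-precedes []      r i = refl
      matches-precedes (c ∷ w) r i rewrite shifted i = begin
        precedes everywhere y (w ʳ++ (c ∷ r)) (suc (length w ℕ.+ i))   ≡⟨ cong (precedes everywhere y (w ʳ++ (c ∷ r))) (ℕₚ.+-suc (length w) i) ⟨
        precedes everywhere y (w ʳ++ (c ∷ r)) (length w ℕ.+ suc i)     ≡⟨ matches-precedes w (c ∷ r) (suc i) ⟩
        m ∧ (e ∧ p)                                                    ≡⟨ Boolₚ.∧-assoc m e p ⟨
        (m ∧ e) ∧ p                                                    ≡⟨ cong (_∧ p) (Boolₚ.∧-comm m e) ⟩
        (e ∧ m) ∧ p                                                    ∎
        where
        open ≡-Reasoning
        m = matches y′ (suc i) w
        e = ⌊ y i Finₚ.≟ c ⌋
        p = precedes everywhere y r i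

      count-occurs : ∀ w n → + count y′ w n ≡ ∑< n (λ i → occurs (reverse w) (length w ℕ.+ i))
      count-occurs w zero    = refl
      count-occurs w (suc n) = trans (ℤₚ.pos-+ (count y′ w n) _)
        (cong₂ _+_ (count-occurs w n)
          (trans (if-ind (matches y′ n w))
            (cong ind (sym (trans (matches-precedes w [] n) (Boolₚ.∧-identityʳ _))))))
        where
        if-ind : ∀ p → + (if p then 1 else 0) ≡ ind p
        if-ind true  = refl
        if-ind false = refl

      -- Counting by starting points instead of end points shifts the index by `length w`, which
      -- costs only a fixed correction.
      error-sublinear : ∀ w → Sublinear (λ n → + (b ℕ.^ length w) * + count y′ w n - + n)
      error-sublinear w = sublinear-dominated
        (λ n → + (b ℕ.^ length w) * + count y′ w n - + n) (deviation (reverse w))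
        (deviation-sublinear (reverse w)) ℓ C
        λ M → suc M , λ n M<n → ℓ ℕ.+ n ,
          ℕₚ.≤-trans (ℕₚ.<⇒≤ M<n) (ℕₚ.m≤n+m n ℓ) , bound n (ℕₚ.≤-trans (s≤s z≤n) M<n) ,
          (begin
            ∣ P * + count y′ w n - + n ∣                  ≡⟨ cong ∣_∣ (shift n) ⟩
            ∣ correction + deviation (reverse w) (ℓ ℕ.+ n) ∣   ≤⟨ ℤₚ.∣i+j∣≤∣i∣+∣j∣ correction _ ⟩
            C ℕ.+ ∣ deviation (reverse w) (ℓ ℕ.+ n) ∣          ∎)
        where
        open ℕₚ.≤-Reasoning
        ℓ = length w
        P = + (b ℕ.^ ℓ)
        early = ∑< ℓ (occurs (reverse w))
        correction = + ℓ - P * early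
        C = ∣ correction ∣
        bound : ∀ n → 1 ≤ n → ℓ ℕ.+ n ≤ suc ℓ ℕ.* n
        bound n@(suc _) _ = subst (_≤ suc ℓ ℕ.* n) (ℕₚ.+-comm n ℓ) (ℕₚ.+-monoʳ-≤ n (ℕₚ.m≤m*n ℓ n))
        ring : ∀ P c e l n → P * c - n ≡ l - P * e + (P * (e + c) - (l + n))
        ring = solve-∀
        shift : ∀ n → P * + count y′ w n - + n ≡ correction + deviation (reverse w) (ℓ ℕ.+ n)
        shift n rewrite length-reverse w | ∑<-split ℓ n (occurs (reverse w)) | sym (count-occurs w n) =
          ring P (+ count y′ w n) early (+ ℓ) (+ n)

      normal : Normal b y′
      -- The factor two makes the final inequality strict.
      normal w ε@(ℚ.mkℚ _ d _) ε>0 with error-sublinear w (2 ℕ.* suc d)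
      ... | N , small = N , λ n N≤n → distance-< (count y′ w (suc n)) n (b ℕ.^ length w) {{P≢0}} ε ε>0
        (ℕₚ.<-≤-trans (half (subst (_≤ suc n) (ℕₚ.*-assoc 2 (suc d) _) (small (suc n) (ℕₚ.m≤n⇒m≤1+n N≤n))))
          (ℕₚ.m≤m*n (suc n) (b ℕ.^ length w) {{P≢0}}))
        where
        P≢0 = ℕₚ.m^n≢0 b (length w)
        half : ∀ {x n} → 2 ℕ.* x ≤ suc n → x < suc n
        half {zero}  _    = s≤s z≤n
        half {suc x} 2x≤n = ℕₚ.<-≤-trans (ℕₚ.m<m+n (suc x) (s≤s z≤n)) 2x≤n

-- Enumeration of the tests

-- A list is coded by a bijective binary numeral: the odd constructor starts a
-- new entry 0, the even one increments the current entry.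
increment : List ℕ → List ℕ
increment []       = []
increment (x ∷ xs) = suc x ∷ xs

toList : ℕᵇ → List ℕ
toList ℕᵇ.zero  = []
toList 2[1+ n ] = increment (toList n)
toList 1+[2 n ] = 0 ∷ toList n

raise : ℕ → ℕᵇ → ℕᵇ
raise zero    n = n
raise (suc x) n = 2[1+ raise x n ]

fromList : List ℕ → ℕᵇ
fromList []       = ℕᵇ.zero
fromList (x ∷ xs) = raise x 1+[2 fromList xs ]

toList-fromList : ∀ xs → toList (fromList xs) ≡ xs
toList-fromList []       = refl
toList-fromList (x ∷ xs) = trans (go x) (cong (x ∷_) (toList-fromList xs))
  where
  go : ∀ x → toList (raise x 1+[2 fromList xs ]) ≡ x ∷ toList (fromList xs)
  go zero    = refl
  go (suc x) = cong increment (go x)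

decode : ℕ → List ℕ
decode = toList ∘ ℕᵇ.fromℕ

encode : List ℕ → ℕ
encode = ℕᵇ.toℕ ∘ fromList

decode-encode : ∀ xs → decode (encode xs) ≡ xs
decode-encode xs = trans (cong toList (ℕᵇₚ.fromℕ-toℕ (fromList xs))) (toList-fromList xs)

-- Patterns of bits are lists of naturals, nonzero meaning selected, so that they share the coding
-- of lists.
nonzeroAt : List ℕ → ℕ → Bool
nonzeroAt []          i       = false
nonzeroAt (zero ∷ xs) zero    = false
nonzeroAt (suc _ ∷ _) zero    = true
nonzeroAt (_ ∷ xs)    (suc i) = nonzeroAt xs i

nonzeroAt-indicator : ∀ (p : ℕ → Bool) n i → i < n →
  nonzeroAt (applyUpTo (λ j → if p j then 1 else 0) n) i ≡ p i
nonzeroAt-indicator p (suc n) zero i<n with p 0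
... | true  = refl
... | false = refl
nonzeroAt-indicator p (suc n) (suc i) (s≤s i<n) with p 0
... | true  = nonzeroAt-indicator (p ∘ suc) n i i<n
... | false = nonzeroAt-indicator (p ∘ suc) n i i<n

-- Position `suc x` reads the bit at `x` modulo the period: periodicity concerns positive positions
-- only, and position zero is never selected.
periodic : List ℕ → ℕ → ℕ → Bool
periodic bits m-1 zero    = false
periodic bits m-1 (suc x) = nonzeroAt bits (x ℕ.% suc m-1)

module _ (b-1 : ℕ) where
  open Digits b-1

  -- The bit pattern enters as one code number, which separates its length from that of the past.
  -- Lists that are too short get the test that selects nothing.
  fromDigits : List ℕ → Test b
  fromDigits (bits ∷ m-1 ∷ c ∷ r) = test (periodic (decode bits) m-1) (mod c) (map mod r)
  fromDigits _                    = test (λ _ → false) zero []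

  allTests : ℕ → Test b
  allTests = fromDigits ∘ decode

  allTests-surjective : ∀ bits m-1 c r → ∃ λ j → allTests j ≡ test (periodic bits m-1) c r
  allTests-surjective bits m-1 c r = encode (encode bits ∷ m-1 ∷ toℕ c ∷ map toℕ r) ,
    trans (cong fromDigits (decode-encode (encode bits ∷ m-1 ∷ toℕ c ∷ map toℕ r)))
      (cong₂ (λ (χ , c) r → test χ c r)
        (cong₂ _,_ (cong (λ bits → periodic bits m-1) (decode-encode bits)) (mod-toℕ c)) (map-mod r))
    where
    map-mod : ∀ r → map mod (map toℕ r) ≡ r
    map-mod []      = refl
    map-mod (c ∷ r) = cong₂ _∷_ (mod-toℕ c) (map-mod r)

-- Periodic sequences as finite bit patterns

module Selection (s : ℕ → ℕ) (inc : StrictlyIncreasingPos s) (m-1 : ℕ)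
  (period : ∀ x → 1 ≤ x →
    ((x ℕ.+ suc m-1) ∈ₛ s → x ∈ₛ s) × (x ∈ₛ s → (x ℕ.+ suc m-1) ∈ₛ s)) where
  open Increasing s inc

  m = suc m-1

  bits : List ℕ
  bits = applyUpTo (λ i → if does (suc i ∈?s) then 1 else 0) m

  shifts : ∀ t x → ((suc x ℕ.+ t ℕ.* m) ∈ₛ s → suc x ∈ₛ s) × (suc x ∈ₛ s → (suc x ℕ.+ t ℕ.* m) ∈ₛ s)
  shifts zero    x rewrite ℕₚ.+-identityʳ x = (λ x∈s → x∈s) , λ x∈s → x∈s
  shifts (suc t) x rewrite ℕₚ.+-comm m (t ℕ.* m) | sym (ℕₚ.+-assoc x (t ℕ.* m) m) =
    let down , up = period (suc x ℕ.+ t ℕ.* m) (s≤s z≤n)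
    in proj₁ (shifts t x) ∘ down , up ∘ proj₂ (shifts t x)

  decompose : ∀ x → suc x ≡ suc (x ℕ.% m) ℕ.+ (x ℕ./ m) ℕ.* m
  decompose x = cong suc (ℕ.m≡m%n+[m/n]*n x m)

  periodic-bits : ∀ x → periodic bits m-1 (suc x) ≡ does (suc (x ℕ.% m) ∈?s)
  periodic-bits x = nonzeroAt-indicator (λ i → does (suc i ∈?s)) m (x ℕ.% m) (ℕ.m%n<n x m)

  sound : ∀ x → periodic bits m-1 x ≡ true → x ∈ₛ s
  sound (suc x) χx with suc (x ℕ.% m) ∈?s | periodic-bits x
  ... | yes r∈s | _  = subst (_∈ₛ s) (sym (decompose x)) (proj₂ (shifts (x ℕ./ m) (x ℕ.% m)) r∈s)
  ... | no _    | eq = contradiction (trans (sym χx) eq) λ ()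

  complete : ∀ x → periodic bits m-1 x ≡ false → ¬ x ∈ₛ s
  complete zero    _  (j , sj≡0) = contradiction (subst (j <_) sj≡0 (n<s j)) λ ()
  complete (suc x) χx x∈s with suc (x ℕ.% m) ∈?s | periodic-bits x
  ... | yes _   | eq = contradiction (trans (sym χx) eq) λ ()
  ... | no r∉s | _  = r∉s (proj₁ (shifts (x ℕ./ m) (x ℕ.% m)) (subst (_∈ₛ s) (decompose x) x∈s))

-- Non-normality and normality of the digit sequence

∧-true : ∀ {p q} → p ∧ q ≡ true → p ≡ true × q ≡ true
∧-true {true} q≡true = refl , q≡true

≟-true : ∀ {n} {x y : Fin n} → ⌊ x Finₚ.≟ y ⌋ ≡ true → x ≡ y
≟-true {x = x} {y} eq with x Finₚ.≟ y
... | yes x≡y = x≡y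

module _ {b : ℕ} (a : ℕ → Fin b) where

  matches-replicate : ∀ z n w i → matches a i (replicate n z ++ w) ≡ true →
    (∀ t → t < n → a (suc i ℕ.+ t) ≡ z) × matches a (i ℕ.+ n) w ≡ true
  matches-replicate z zero    w i eq rewrite ℕₚ.+-identityʳ i = (λ _ ()) , eq
  matches-replicate z (suc n) w i eq with ∧-true eq
  ... | hd , tl with matches-replicate z n w (suc i) tl
  ... | zs , rest rewrite ℕₚ.+-suc i n = all , rest
    where
    all : ∀ t → t < suc n → a (suc i ℕ.+ t) ≡ z
    all zero    _         = trans (cong (a ∘ suc) (ℕₚ.+-identityʳ i)) (≟-true hd)
    all (suc t) (s≤s t<n) = trans (cong a (cong suc (ℕₚ.+-suc i t))) (zs t t<n)

  count≤n : ∀ w n → count a w n ≤ n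
  count≤n w zero    = z≤n
  count≤n w (suc n) with matches a n w
  ... | true  = ℕₚ.≤-trans (ℕₚ.+-monoˡ-≤ 1 (count≤n w n)) (ℕₚ.≤-reflexive (ℕₚ.+-comm n 1))
  ... | false = ℕₚ.≤-trans (ℕₚ.+-monoˡ-≤ 0 (count≤n w n)) (ℕₚ.≤-trans (ℕₚ.≤-reflexive (ℕₚ.+-identityʳ n)) (ℕₚ.n≤1+n n))

  count-bounded : ∀ w L → (∀ i → L ≤ i → matches a i w ≢ true) → ∀ n → count a w n ≤ L
  count-bounded w L never zero    = z≤n
  count-bounded w L never (suc n) with ℕₚ.≤-total L n
  ... | inj₂ n≤L with ℕₚ.m≤n⇒m<n∨m≡n n≤L
  ...   | inj₁ n<L  = ℕₚ.≤-trans (count≤n w (suc n)) n<L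
  ...   | inj₂ refl with matches a n w in eq
  ...     | true  = contradiction eq (never n ℕₚ.≤-refl)
  ...     | false = ℕₚ.≤-trans (ℕₚ.≤-reflexive (ℕₚ.+-identityʳ _)) (count-bounded w L never n)
  count-bounded w L never (suc n) | inj₁ L≤n with matches a n w in eq
  ... | true  = contradiction eq (never n L≤n)
  ... | false = ℕₚ.≤-trans (ℕₚ.≤-reflexive (ℕₚ.+-identityʳ _)) (count-bounded w L never n)

-- A bounded count has frequency tending to zero, so its distance from `1 / B` eventually exceeds
-- `1 / (2 B + 1)`.
not-normal : ∀ b .{{_ : NonZero b}} (a : ℕ → Fin b) w L → (∀ n → count a w n ≤ L) → ¬ Normal b a
not-normal b a w L count≤L normal
  with normal w ((+ 1) ℚ./ suc (B ℕ.+ B)) (ℚₚ.normalize-pos 1 (suc (B ℕ.+ B)))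
  where B = b ℕ.^ length w
... | N , close = ℕₚ.<⇒≱
    (distance-<⁻¹ c n B {{P≢0}} (B ℕ.+ B) (close n (ℕₚ.m≤m+n N _)))
    (begin
      suc n ℕ.* B                ≤⟨ ℕₚ.*-monoˡ-≤ B far ⟩
      (e ℕ.+ e) ℕ.* B            ≡⟨ ℕₚ.*-comm (e ℕ.+ e) B ⟩
      B ℕ.* (e ℕ.+ e)            ≡⟨ trans (ℕₚ.*-distribˡ-+ B e e) (sym (ℕₚ.*-distribʳ-+ e B B)) ⟩
      (B ℕ.+ B) ℕ.* e            ≤⟨ ℕₚ.m≤n+m _ e ⟩
      suc (B ℕ.+ B) ℕ.* e        ∎)
  where
  open ℕₚ.≤-Reasoning
  B = b ℕ.^ length w
  P≢0 = ℕₚ.m^n≢0 b (length w)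
  -- Large enough for `B * L ≤ e`, hence `suc n ≤ e + e`.
  n = N ℕ.+ (B ℕ.* L ℕ.+ B ℕ.* L)
  c = count a w (suc n)
  e = error c n B {{P≢0}}
  cancel : ∀ x y → y ≡ x - (x - y)
  cancel = solve-∀
  n≤e : suc n ≤ B ℕ.* L ℕ.+ e
  n≤e = begin
    suc n                                          ≡⟨ cong ∣_∣ (cancel (+ B * + c) (+ suc n)) ⟩
    ∣ + B * + c - (+ B * + c - + suc n) ∣          ≤⟨ ℤₚ.∣i-j∣≤∣i∣+∣j∣ (+ B * + c) _ ⟩
    ∣ + B * + c ∣ ℕ.+ e                            ≡⟨ cong (ℕ._+ e) (ℤₚ.abs-* (+ B) (+ c)) ⟩
    B ℕ.* c ℕ.+ e                                  ≤⟨ ℕₚ.+-monoˡ-≤ e (ℕₚ.*-monoʳ-≤ B (count≤L (suc n))) ⟩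
    B ℕ.* L ℕ.+ e                                  ∎
  BL≤e : B ℕ.* L ≤ e
  BL≤e = ℕₚ.+-cancelˡ-≤ (B ℕ.* L) _ _ (ℕₚ.≤-trans (ℕₚ.m≤n+m _ (suc N)) n≤e)
  far : suc n ≤ e ℕ.+ e
  far = ℕₚ.≤-trans n≤e (ℕₚ.+-monoˡ-≤ e BL≤e)

-- The word that does not occur

module AbsentWord (b-2 k L : ℕ) (1≤L : 1 ≤ L) (digit : ℕ → Fin (suc (suc b-2)))
  (free : ℕ → Vec (Fin (suc (suc b-2))) k)
  (digit-block : ∀ n i → i ≤ k →
    digit (Blocks.base k L 1≤L n ℕ.+ i) ≡ Digits.block (suc b-2) (free n) i) where
  open Digits (suc b-2)
  open Blocks k L 1≤L

  one : Fin b
  one = suc zero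

  -- A run of `k` zeros on either side covers every alignment with the blocks. The trailing empty
  -- list puts the second run in the form of `matches-replicate`.
  word : List (Fin b)
  word = replicate k zero ++ one ∷ replicate k zero ++ []

  word-spec : ∀ i → matches digit i word ≡ true →
    digit (suc i ℕ.+ k) ≡ one × (∀ u → u ≤ k ℕ.+ k → u ≢ k → digit (suc i ℕ.+ u) ≡ zero)
  word-spec i eq with matches-replicate digit zero k (one ∷ replicate k zero ++ []) i eq
  ... | front , rest with ∧-true rest
  ... | mid , rest′ with matches-replicate digit zero k [] (suc (i ℕ.+ k)) rest′
  ... | back , _ = ≟-true mid , zeros
    where
    zeros : ∀ u → u ≤ k ℕ.+ k → u ≢ k → digit (suc i ℕ.+ u) ≡ zero
    zeros u u≤2k u≢k with ℕₚ.<-cmp u k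
    ... | tri< u<k _ _ = front u u<k
    ... | tri≈ _ u≡k _ = contradiction u≡k u≢k
    ... | tri> _ _ k<u = subst (λ z → digit z ≡ zero) reindex (back (u ℕ.∸ suc k) small)
      where
      small : u ℕ.∸ suc k < k
      small = ℕₚ.+-cancelˡ-< (suc k) _ _ (subst (_< suc k ℕ.+ k) (sym (ℕₚ.m+[n∸m]≡n k<u)) (s≤s u≤2k))
      reindex : suc (suc (i ℕ.+ k)) ℕ.+ (u ℕ.∸ suc k) ≡ suc i ℕ.+ u
      reindex = cong suc (trans (cong (ℕ._+ (u ℕ.∸ suc k)) (sym (ℕₚ.+-suc i k)))
        (trans (ℕₚ.+-assoc i (suc k) _) (cong (i ℕ.+_) (ℕₚ.m+[n∸m]≡n k<u))))

  -- A block beginning inside the occurrence, at most k places after its start,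
  -- contains the digit 1 exactly once, against the rule for its last digit.
  word-absent : ∀ i → L ≤ i → matches digit i word ≢ true
  word-absent i L≤i eq with locate i L≤i | word-spec i eq
  ... | N , base≤i , i<base | at-k , zeros = absurd (p ℕₚ.≟ 0)
    where
    -- The first block starting after `i`. It starts `p` places into the occurrence, so the digit
    -- one has offset `k ∸ p` in it.
    n = suc N
    v = free n
    p = base n ℕ.∸ suc i
    base≡ : suc i ℕ.+ p ≡ base n
    base≡ = ℕₚ.m+[n∸m]≡n i<base
    p≤k : p ≤ k
    p≤k = ℕₚ.+-cancelˡ-≤ (suc i) _ _ (begin
      suc i ℕ.+ p            ≡⟨ base≡ ⟩
      base n                 ≡⟨ base-suc N ⟩
      base N ℕ.+ suc k       ≤⟨ ℕₚ.+-monoˡ-≤ (suc k) base≤i ⟩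
      i ℕ.+ suc k            ≡⟨ ℕₚ.+-suc i k ⟩
      suc i ℕ.+ k            ∎)
      where open ℕₚ.≤-Reasoning
    block-digit : ∀ t → t ≤ k → block v t ≡ digit (suc i ℕ.+ (p ℕ.+ t))
    block-digit t t≤k = trans (sym (digit-block n t t≤k))
      (cong digit (trans (cong (ℕ._+ t) (sym base≡)) (ℕₚ.+-assoc (suc i) p t)))
    block-zero : ∀ t → t ≤ k → p ℕ.+ t ≢ k → block v t ≡ zero
    block-zero t t≤k ≢k = trans (block-digit t t≤k) (zeros (p ℕ.+ t) (ℕₚ.+-mono-≤ p≤k t≤k) ≢k)
    block-one : ∀ t → t ≤ k → p ℕ.+ t ≡ k → block v t ≡ one
    block-one t t≤k ≡k = trans (block-digit t t≤k) (trans (cong (λ u → digit (suc i ℕ.+ u)) ≡k) at-k)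
    last : block v k ≡ total v
    last = lookupOr-≥ v (total v) k ℕₚ.≤-refl
    zero≢one : zero ≢ one
    zero≢one ()
    absurd : Dec (p ≡ 0) → _
    -- The digit one is the check digit, over free digits that are all zero.
    absurd (yes p≡0) = zero≢one (trans
      (sym (total-zero v (total v) λ t t<k → block-zero t (ℕₚ.<⇒≤ t<k)
        λ eq → ℕₚ.<⇒≢ t<k (trans (cong (ℕ._+ t) (sym p≡0)) eq)))
      (trans (sym last) (block-one k ℕₚ.≤-refl (cong (ℕ._+ k) p≡0))))
    -- The digit one is among the free digits, so the check digit should be one, but it is zero.
    absurd (no p≢0) = zero≢one (trans
      (sym (block-zero k ℕₚ.≤-refl λ eq → p≢0 (ℕₚ.+-cancelʳ-≡ k p 0 eq)))
      (trans last (total-single v (total v) one (k ℕ.∸ p) k∸p<k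
        (block-one (k ℕ.∸ p) (ℕₚ.m∸n≤m k p) p+k∸p≡k)
        λ t t<k t≢ → block-zero t (ℕₚ.<⇒≤ t<k) λ eq → t≢ (ℕₚ.+-cancelˡ-≡ p _ _ (trans eq (sym p+k∸p≡k))))))
      where
      p+k∸p≡k : p ℕ.+ (k ℕ.∸ p) ≡ k
      p+k∸p≡k = ℕₚ.m+[n∸m]≡n p≤k
      k∸p<k : k ℕ.∸ p < k
      k∸p<k = ℕₚ.∸-monoʳ-< (ℕₚ.n≢0⇒n>0 p≢0) p≤k

  digit-not-normal : ¬ Normal b digit
  digit-not-normal = not-normal b digit word L (count-bounded digit word L word-absent)

-- Normality along the periodic selections

module SparseSelections (b-1 k L : ℕ) (1≤L : 1 ≤ L) (digit : ℕ → Fin (suc b-1))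
  (score-sublinear : ∀ j → (∀ n → Blocks.Gap k L 1≤L (Test.select (allTests b-1 j)) n) →
    Sublinear (λ x → ∑< x (Scores.score (allTests b-1 j) digit))) where
  open Digits b-1 using (b)
  open Blocks k L 1≤L

  subseq-normal : ∀ s → StrictlyIncreasingPos s → Periodic s →
    (∀ n → 1 ≤ n → ¬ BlockSubset (suc k) L n s) → Normal b (subseq digit s)
  subseq-normal s inc (suc m-1 , 1≤m , period) sparse =
    normal sub (subseq digit s) (λ _ → refl)
    where
    open Normality {b-1} (digit ∘ s)
    open Scores {b-1} using (score)
    open Selection s inc m-1 period
    χ = periodic bits m-1
    open Subsequence {b-1} s inc χ sound complete digit
    gap : ∀ n → Gap χ n
    -- The search for a gap is finite and decidable, so the negated inclusion yields an actual gap.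
    -- Block `n` here is block `suc n` of the hypothesis, which counts from one.
    gap n = decidable-stable (gap? χ n) λ ¬gap → sparse (suc n) (s≤s z≤n) λ x lower upper →
      let base≡ : suc k ℕ.* n ℕ.+ L ≡ base n
          base≡ = trans (ℕₚ.+-comm _ L) (cong (L ℕ.+_) (ℕₚ.*-comm (suc k) n))
          base≤x = subst (_≤ x) base≡ lower
          q = x ℕ.∸ base n
          x≡ = ℕₚ.m+[n∸m]≡n base≤x
          q<K : q < suc k
          q<K = ℕₚ.+-cancelˡ-< (base n) _ _ (subst₂ _<_ (sym x≡)
            (trans (trans (ℕₚ.+-comm _ L) (cong (L ℕ.+_) (ℕₚ.*-comm (suc k) (suc n)))) (base-suc n)) upper)
      in selected ¬gap x q q<K x≡
      where
      selected : ¬ Gap χ n → ∀ x q → q < suc k → base n ℕ.+ q ≡ x → x ∈ₛ s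
      selected ¬gap x q q<K refl with χ x in χx
      ... | true  = sound x χx
      ... | false = contradiction (q , q<K , χx) ¬gap
    sub : ∀ c r → Sublinear (λ n → ∑< n (score (test everywhere c r) (digit ∘ s)))
    sub c r with allTests-surjective b-1 bits m-1 c r
    ... | j , eq = score-subseq-sublinear m 1≤m shift c r
      (subst (λ τ → Sublinear (λ x → ∑< x (score τ digit))) eq
        (score-sublinear j λ n → subst (λ τ → Gap (Test.select τ) n) (sym eq) (gap n)))
      where
      shift : ∀ x → x ∈ₛ s → (x ℕ.+ m) ∈ₛ s
      shift zero    0∈s = contradiction 0∈s (complete 0 refl)
      shift (suc x) x∈s = proj₂ (period (suc x) (s≤s z≤n)) x∈s

theorem1p4 : (b : ℕ) → .{{_ : NonZero b}} → 2 ≤ b →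
    (𝒩 : (ℕ → ℕ) → Set) →
    ((s : ℕ → ℕ) → 𝒩 s → StrictlyIncreasingPos s × Periodic s) →
    (∃ λ K → ∃ λ L → (1 ≤ K) × (1 ≤ L) ×
      ((n : ℕ) → 1 ≤ n → (s : ℕ → ℕ) → 𝒩 s → ¬ BlockSubset K L n s)) →
    Σ (ℕ → Fin b) λ a → (¬ Normal b a) × ((s : ℕ → ℕ) → 𝒩 s → Normal b (subseq a s))
theorem1p4 (suc (suc b-2)) (s≤s (s≤s _)) 𝒩 periodic-seqs (suc k , L , _ , 1≤L , sparse) =
  digit , digit-not-normal , λ s s∈𝒩 →
    subseq-normal s (proj₁ (periodic-seqs s s∈𝒩)) (proj₂ (periodic-seqs s s∈𝒩))
      (λ n 1≤n → sparse n 1≤n s s∈𝒩)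
  where
  open Construction (suc b-2) k L 1≤L (allTests (suc b-2))
  open AbsentWord b-2 k L 1≤L digit G.chosen digit-block
  open SparseSelections (suc b-2) k L 1≤L digit score-sublinear
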